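{- Let $G$ be a graph on $n$ vertices with adjacency matrix $A(G)$ and walk-matrix $W(G)$, and suppose $\det W(G)\neq 0$. Let $d_n=d_n(W(G))$ be the $n$-th invariant factor of $W(G)$. Suppose that $Q\in\mathcal{Q}(G)$ has level $\ell$. Then: (i) for an odd prime $p$, if $\operatorname{rank}_p W(G)=n-1$, then $\ell\mid \frac{d_n}{p}$; (ii) for $p=2$, if $\operatorname{rank}_2 W(G)=\lceil \frac n2\rceil$, then $\ell\mid \frac{d_n}{2}$.
   Context: All graphs are simple. The walk-matrix of a graph $G$ on $n$ vertices with adjacency matrix $A=A(G)$ is the $n\times n$ integral matrix $W(G)=[e,Ae,\ldots,A^{n-1}e]$, where $e$ is the all-one vector. For a prime $p$, $\operatorname{rank}_p X$ is the rank of an integral matrix $X$ over the finite field $\mathbb{F}_p$. For an $n\times n$ integral matrix $X$ of full rank, $d_1(X)\mid d_2(X)\mid\cdots\mid d_n(X)$ denote the invariant factors of $X$, i.e. the diagonal entries of its Smith Normal Form. A rational orthogonal matrix $Q$ (orthogonal with rational entries) is regular if $Qe=e$; $RO_n(\mathbb{Q})$ is the set of all $n\times n$ regular rational orthogonal matrices, and $\mathcal{Q}(G)=\{Q\in RO_n(\mathbb{Q}) : Q^{T}A(G)Q \text{ is a } (0,1)\text{ -matrix}\}$. The level of a rational matrix $Q$ is the smallest positive integer $k$ such that $kQ$ is an integral matrix.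
   Formalization: Part (ii) is stated for n ≥ 2: for n = 1 the walk-matrix is [1], its rank over F_2 is 1 = ⌈1/2⌉, d_1 = 1 and ℓ = 1, so d_1/2 is not an integer and the claim fails. -}

module Defs where

open import Algebra.Bundles using (CommutativeRing)
open import Data.Bool.Base using (Bool; false; if_then_else_)
open import Data.Fin.Base as Fin using (Fin; zero; suc; toℕ; punchIn)
open import Data.Fin.Properties using (_≟_)
open import Data.Integer.Base as ℤ using (ℤ; +_)
import Data.Integer.Divisibility.Signed as ℤ∣
import Data.Integer.Properties as ℤ
import Data.Integer.Tactic.RingSolver as ℤSolver
open import Data.Nat.Base as ℕ using (ℕ; zero; suc)
open import Data.Nat.Divisibility using (_∣_; quotient)
open import Data.Product.Base using (Σ-syntax; ∃-syntax; _×_; _,_)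
open import Data.Rational.Base as ℚ using (ℚ)
import Data.Rational.Properties as ℚ
open import Data.Sum.Base using (_⊎_)
open import Data.Vec.Functional using (Vector)
open import Level using (0ℓ)
open import Relation.Binary.PropositionalEquality using (_≡_; refl; cong; subst)
open import Relation.Nullary.Decidable using (does)

Matrix : ∀ {a} → Set a → ℕ → ℕ → Set a
Matrix A m n = Fin m → Fin n → A

_ᵀ : ∀ {a} {A : Set a} {m n} → Matrix A m n → Matrix A n m
(X ᵀ) i j = X j i

record Graph (n : ℕ) : Set where
  field
    edge        : Fin n → Fin n → Bool
    symmetric   : ∀ i j → edge i j ≡ edge j i
    irreflexive : ∀ i → edge i i ≡ false

module MatrixAlgebra {c ℓ} (R : CommutativeRing c ℓ) where
  open CommutativeRing R hiding (zero)
  open import Algebra.Properties.Semiring.Exp semiring using (_^_)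
  open import Algebra.Properties.Semiring.Sum semiring public using (sum)

  infix  4 _≈ᵛ_ _≈ᴹ_
  infixl 7 _*ᴹ_ _*ᵛ_

  _≈ᵛ_ : ∀ {n} → Vector Carrier n → Vector Carrier n → Set ℓ
  u ≈ᵛ v = ∀ i → u i ≈ v i

  _≈ᴹ_ : ∀ {m n} → Matrix Carrier m n → Matrix Carrier m n → Set ℓ
  X ≈ᴹ Y = ∀ i j → X i j ≈ Y i j

  _*ᴹ_ : ∀ {l m n} → Matrix Carrier l m → Matrix Carrier m n → Matrix Carrier l n
  (X *ᴹ Y) i j = sum λ k → X i k * Y k j

  _*ᵛ_ : ∀ {m n} → Matrix Carrier m n → Vector Carrier n → Vector Carrier m
  (X *ᵛ v) i = sum λ k → X i k * v k

  diag : ∀ {n} → Vector Carrier n → Matrix Carrier n n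
  diag d i j = if does (i ≟ j) then d i else 0#

  ones : ∀ {n} → Vector Carrier n
  ones _ = 1#

  Id : ∀ {n} → Matrix Carrier n n
  Id = diag ones

  IsInverse : ∀ {n} → Matrix Carrier n n → Matrix Carrier n n → Set ℓ
  IsInverse X Y = (X *ᴹ Y ≈ᴹ Id) × (Y *ᴹ X ≈ᴹ Id)

  Invertible : ∀ {n} → Matrix Carrier n n → Set _
  Invertible X = ∃[ Y ] IsInverse X Y

  Orthogonal : ∀ {n} → Matrix Carrier n n → Set ℓ
  Orthogonal X = IsInverse X (X ᵀ)

  -- Laplace expansion along the first row.
  det : ∀ {n} → Matrix Carrier n n → Carrier
  det {zero}  X = 1#
  det {suc n} X = sum λ j →
    (- 1#) ^ toℕ j * (X zero j * det (λ i k → X (suc i) (punchIn j k)))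

  linearCombination : ∀ {m r} → Vector Carrier r → Vector (Vector Carrier m) r →
                      Vector Carrier m
  linearCombination a b i = sum λ k → a k * b k i

  LinearlyIndependent : ∀ {m r} → Vector (Vector Carrier m) r → Set _
  LinearlyIndependent b =
    ∀ a → linearCombination a b ≈ᵛ (λ _ → 0#) → a ≈ᵛ (λ _ → 0#)

  InSpan : ∀ {m r} → Vector (Vector Carrier m) r → Vector Carrier m → Set _
  InSpan b v = ∃[ a ] linearCombination a b ≈ᵛ v

  -- The column space has a basis of size r.  This is the usual notion of rank
  -- only when R is a field.  Note that X ᵀ, as a family of vectors, is the
  -- family of columns of X.
  HasRank : ∀ {m n} → Matrix Carrier m n → ℕ → Set _
  HasRank {m} X r = Σ[ b ∈ Vector (Vector Carrier m) r ]
    LinearlyIndependent b × (∀ k → InSpan (X ᵀ) (b k)) × (∀ j → InSpan b ((X ᵀ) j))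

  adjacency : ∀ {n} → Graph n → Matrix Carrier n n
  adjacency G i j = if Graph.edge G i j then 1# else 0#

  walkVector : ∀ {n} → Graph n → ℕ → Vector Carrier n
  walkVector G zero    = ones
  walkVector G (suc k) = adjacency G *ᵛ walkVector G k

  walkMatrix : ∀ {n} → Graph n → Matrix Carrier n n
  walkMatrix G i j = walkVector G (toℕ j) i

module ℤᴹ = MatrixAlgebra ℤ.+-*-commutativeRing
module ℚᴹ = MatrixAlgebra ℚ.+-*-commutativeRing

-- The ring ℤ/pℤ, with integers as carrier and congruence modulo p as equality;
-- it is the field 𝔽ₚ when p is prime.  Reducing an integral matrix modulo p
-- thus leaves its entries unchanged.
module _ (p : ℕ) where

  infix 4 _≡ₚ_

  record _≡ₚ_ (x y : ℤ) : Set where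
    constructor congruent
    field difference : + p ℤ∣.∣ x ℤ.- y

  private
    reflexive : ∀ {x y} → x ≡ y → x ≡ₚ y
    reflexive {x} refl =
      congruent (ℤ∣.divides (+ 0) (ℤ.+-inverseʳ x))

    cast : ∀ {x y z} → z ≡ x ℤ.- y → + p ℤ∣.∣ z → x ≡ₚ y
    cast eq d = congruent (subst (+ p ℤ∣.∣_) eq d)

    sym-eq : ∀ x y → ℤ.- (x ℤ.- y) ≡ y ℤ.- x
    sym-eq = ℤSolver.solve-∀

    trans-eq : ∀ x y z → (x ℤ.- y) ℤ.+ (y ℤ.- z) ≡ x ℤ.- z
    trans-eq = ℤSolver.solve-∀

    +-eq : ∀ x y u v → (x ℤ.- y) ℤ.+ (u ℤ.- v) ≡ (x ℤ.+ u) ℤ.- (y ℤ.+ v)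
    +-eq = ℤSolver.solve-∀

    *-eq : ∀ x y u v →
           u ℤ.* (x ℤ.- y) ℤ.+ y ℤ.* (u ℤ.- v) ≡ x ℤ.* u ℤ.- y ℤ.* v
    *-eq = ℤSolver.solve-∀

    neg-eq : ∀ x y → ℤ.- (x ℤ.- y) ≡ (ℤ.- x) ℤ.- (ℤ.- y)
    neg-eq = ℤSolver.solve-∀

    module Z = CommutativeRing ℤ.+-*-commutativeRing

  ℤ/ : CommutativeRing 0ℓ 0ℓ
  ℤ/ = record
    { Carrier = ℤ
    ; _≈_ = _≡ₚ_
    ; _+_ = ℤ._+_
    ; _*_ = ℤ._*_
    ; -_  = ℤ.-_
    ; 0#  = + 0
    ; 1#  = + 1
    ; isCommutativeRing = record
      { isRing = record
        { +-isAbelianGroup = record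
          { isGroup = record
            { isMonoid = record
              { isSemigroup = record
                { isMagma = record
                  { isEquivalence = record
                    { refl  = reflexive refl
                    ; sym   = λ { {x} {y} (congruent d) →
                        cast (sym-eq x y) (ℤ∣.∣m⇒∣-m d) }
                    ; trans = λ { {x} {y} {z} (congruent d) (congruent e) →
                        cast (trans-eq x y z) (ℤ∣.∣m∣n⇒∣m+n d e) }
                    }
                  ; ∙-cong = λ { {x} {y} {u} {v} (congruent d) (congruent e) →
                      cast (+-eq x y u v) (ℤ∣.∣m∣n⇒∣m+n d e) }
                  }
                ; assoc = λ x y z → reflexive (Z.+-assoc x y z)
                }
              ; identity = (λ x → reflexive (Z.+-identityˡ x))
                         , (λ x → reflexive (Z.+-identityʳ x))
              }
            ; inverse = (λ x → reflexive (Z.-‿inverseˡ x))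
                      , (λ x → reflexive (Z.-‿inverseʳ x))
            ; ⁻¹-cong = λ { {x} {y} (congruent d) →
                cast (neg-eq x y) (ℤ∣.∣m⇒∣-m d) }
            }
          ; comm = λ x y → reflexive (Z.+-comm x y)
          }
        ; *-cong = λ { {x} {y} {u} {v} (congruent d) (congruent e) →
            cast (*-eq x y u v)
              (ℤ∣.∣m∣n⇒∣m+n (ℤ∣.∣n⇒∣m*n u d) (ℤ∣.∣n⇒∣m*n y e)) }
        ; *-assoc = λ x y z → reflexive (Z.*-assoc x y z)
        ; *-identity = (λ x → reflexive (Z.*-identityˡ x))
                     , (λ x → reflexive (Z.*-identityʳ x))
        ; distrib = (λ x y z → reflexive (Z.distribˡ x y z))
                  , (λ x y z → reflexive (Z.distribʳ x y z))
        }
      ; *-comm = λ x y → reflexive (Z.*-comm x y)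
      }
    }

HasRankMod : ∀ {m n} → ℕ → Matrix ℤ m n → ℕ → Set
HasRankMod p = MatrixAlgebra.HasRank (ℤ/ p)

-- d lists the diagonal entries of the Smith normal form of X, normalised to be
-- nonnegative, so that d is determined by X.
IsInvariantFactors : ∀ {n} → Matrix ℤ n n → Vector ℕ n → Set
IsInvariantFactors {n} X d =
  (∀ i j → i Fin.≤ j → d i ∣ d j) ×
  (Σ[ U ∈ Matrix ℤ n n ] Σ[ V ∈ Matrix ℤ n n ]
     Invertible U × Invertible V × U *ᴹ X *ᴹ V ≈ᴹ diag (λ i → + d i))
  where open ℤᴹ

-- Regular rational orthogonal matrices.
RO : ∀ n → Matrix ℚ n n → Set
RO n Q = Orthogonal Q × Q *ᵛ ones ≈ᵛ ones
  where open ℚᴹ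

IsZeroOne : ∀ {m n} → Matrix ℚ m n → Set
IsZeroOne X = ∀ i j → X i j ≡ ℚ.0ℚ ⊎ X i j ≡ ℚ.1ℚ

infix 4 _∈𝒬_

_∈𝒬_ : ∀ {n} → Matrix ℚ n n → Graph n → Set
_∈𝒬_ {n} Q G = RO n Q × IsZeroOne (Q ᵀ *ᴹ adjacency G *ᴹ Q)
  where open ℚᴹ

IsIntegral : ∀ {m n} → Matrix ℚ m n → Set
IsIntegral X = ∀ i j → ∃[ z ] X i j ≡ z ℚ./ 1

scale : ∀ {m n} → ℕ → Matrix ℚ m n → Matrix ℚ m n
scale k X i j = (+ k ℚ./ 1) ℚ.* X i j

IsLevel : ∀ {m n} → Matrix ℚ m n → ℕ → Set
IsLevel Q l = 0 ℕ.< l × IsIntegral (scale l Q) ×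
              (∀ k → 0 ℕ.< k → IsIntegral (scale k Q) → l ℕ.≤ k)

-- d / p is an integer, and l divides it.  (Floor division would make this
-- weaker when p does not divide d.)
DividesQuotient : (l d p : ℕ) → Set
DividesQuotient l d p = Σ[ p∣d ∈ p ∣ d ] l ∣ quotient p∣d

{-# OPTIONS --safe #-}
module Submission where

-- Write e for the all-one vector, W′ = QᵀW for the walk matrix of B = QᵀAQ, d for the
-- last invariant factor, and let p be a prime with rank_p W < n, so that p ∣ d.  In
-- Smith coordinates d Qᵀ = W′(d W⁻¹) is divisible by p as soon as ker W ⊆ ker W′
-- modulo p, and then ℓ ∣ d / p.
--
-- If p = 2 and rank W = ⌈n/2⌉: the characteristic polynomial φ of the alternating
-- matrix A satisfies f² ≡ φ or f² ≡ x φ for some f of degree ⌈n/2⌉, and φ(A) = 0 also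
-- gives φ(B) = 0.  For symmetric M, f(M)e is the diagonal of f(M)² modulo 2, so
-- f(A)e ≡ f(B)e ≡ 0.  As deg f is the rank, ker W consists of the multiples of f.
--
-- If rank W = n - 1: ker W and ker Wᵀ are lines spanned by v and y, Ay ≡ μy, and
-- d Qᵀ is a multiple of w yᵀ for w = W′v.  If w ≢ 0, then QᵀA = BQᵀ forces Bw ≡ μw, and
-- WᵀW = W′ᵀW′ makes W′ singular, which a comparison of the polynomials in the two
-- kernels excludes.

open import Defs
open import Algebra.Bundles using (CommutativeMonoid; CommutativeRing)
open import Data.Bool.Base using (true; false)
open import Data.Fin.Base using (Fin; zero; suc; toℕ; fromℕ; inject₁; punchIn; punchOut)
open import Data.Fin.Induction using (<-weakInduction; >-weakInduction)
open import Data.Fin.Properties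
  using (_≟_; any?; fromℕ≢inject₁; punchIn-punchOut; toℕ-fromℕ; toℕ-inject₁; ≤fromℕ)
open import Data.Fin.Relation.Unary.Top using (view; ‵fromℕ; ‵inject₁)
open import Data.Integer.Base as ℤ using (ℤ; +_; 0ℤ; 1ℤ; -1ℤ)
open import Data.Integer.Divisibility.Signed as ℤ∣ using (divides) renaming (_∣_ to _∣ᶻ_)
import Data.Integer.Properties as ℤ
open import Data.Integer.Tactic.RingSolver using (solve-∀)
open import Data.List.Base as List using (List; []; _∷_; length)
open import Data.List.Relation.Binary.Pointwise using (Pointwise; []; _∷_)
open import Data.Nat.Base as ℕ using (ℕ; zero; suc; _≤_; _∸_; ⌈_/2⌉; ⌊_/2⌋)
import Data.Nat.DivMod as ℕ
open import Data.Nat.Divisibility as ℕ∣ using (_∣_; quotient)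
open import Data.Nat.Primality using (Prime; euclidsLemma; prime⇒nonTrivial; prime⇒nonZero; prime[2])
import Data.Nat.Properties as ℕ
open import Data.Product.Base using (Σ-syntax; ∃-syntax; _×_; _,_; proj₁; proj₂)
open import Data.Rational.Base as ℚ using (ℚ)
import Data.Rational.Properties as ℚ
import Data.Rational.Unnormalised.Base as ℚᵘ
import Data.Rational.Unnormalised.Properties as ℚᵘ
open import Data.Sum.Base as Sum using (_⊎_; inj₁; inj₂)
open import Data.Unit.Base using (⊤)
open import Data.Vec.Functional using (Vector)
open import Function.Base using (_∘_)
open import Level using (Lift; lift; _⊔_)
open import Relation.Binary.PropositionalEquality as ≡ using (_≡_; _≢_; refl)
open import Relation.Nullary using (¬_; Dec; yes; no; does; ¬?)
open import Relation.Nullary.Decidable using (decidable-stable; map′)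
open import Relation.Nullary.Negation using (contradiction)

-- Linear algebra over a commutative ring

-- The obstacle is that p may divide ℓ, so neither Q nor B = QᵀAQ can be reduced modulo p. Hence Q
-- is replaced by the integer matrix L = ℓQ, identities that involve L are proved over ℤ, the
-- factors ℓ are cancelled there, and only consequences free of L are reduced: WᵀW = W′ᵀW′, the
-- relation QᵀA = BQᵀ multiplied by d with d Qᵀ written as W′Y, and φ(B) = 0. The last is why
-- Cayley-Hamilton is needed over ℤ: with ℓ even, φ(A) ≡ 0 modulo 2 alone would not pass to B
-- through L. For this reason the linear algebra is done over an arbitrary commutative ring and used
-- for ℤ, ℚ and ℤ/p. Coefficient vectors stand for polynomials of bounded degree, with W v = v(A)e,
-- so ker W is a space of polynomials on which multiplication by x is a partial shift. Determinants
-- are avoided: the characteristic polynomial comes from a recursion on the first row and column,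
-- and singularity always means an explicit kernel vector.

module LinearAlgebra {c ℓ} (R : CommutativeRing c ℓ) where
  open CommutativeRing R hiding (zero; refl; ring)
  open CommutativeRing R using () renaming (refl to ≈-refl)
  open MatrixAlgebra R
  open import Algebra.Properties.Semiring.Sum semiring
    using (sum-cong-≋; sum-replicate-zero; ∑-distrib-+; ∑-comm; *-distribˡ-sum; *-distribʳ-sum)
  open import Relation.Binary.Reasoning.Setoid setoid

  open import Algebra.Properties.CommutativeSemigroup *-commutativeSemigroup
    using (x∙yz≈y∙xz; x∙yz≈yx∙z)
  open import Algebra.Properties.CommutativeSemigroup
    (CommutativeMonoid.commutativeSemigroup +-commutativeMonoid) using (interchange)

  private
    rearrange : ∀ a b x y z → z * (a * x + b * y) ≈ a * (z * x) + b * (z * y)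
    rearrange a b x y z = trans (distribˡ z _ _) (+-cong (x∙yz≈y∙xz z a x) (x∙yz≈y∙xz z b y))

    horner-step : ∀ a b c x y u v →
      c * (a * x + b * y) + (a * u + b * v) ≈ a * (c * x + u) + b * (c * y + v)
    horner-step a b c x y u v = trans (+-congʳ (rearrange a b x y c))
      (trans (interchange _ _ _ _) (+-cong (sym (distribˡ a _ _)) (sym (distribˡ b _ _))))

  lincomb : ∀ {n} → Carrier → Vector Carrier n → Carrier → Vector Carrier n → Vector Carrier n
  lincomb a u b v i = a * u i + b * v i

  dot : ∀ {n} → Vector Carrier n → Vector Carrier n → Carrier
  dot u v = sum λ k → u k * v k

  sum-zero : ∀ {n} {f : Vector Carrier n} → (∀ i → f i ≈ 0#) → sum f ≈ 0#
  sum-zero {n} f≈0 = trans (sum-cong-≋ f≈0) (sum-replicate-zero n)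

  dot-cong : ∀ {n} {u u′ v v′ : Vector Carrier n} → u ≈ᵛ u′ → v ≈ᵛ v′ → dot u v ≈ dot u′ v′
  dot-cong u≈ v≈ = sum-cong-≋ λ i → *-cong (u≈ i) (v≈ i)

  dot-zeroˡ : ∀ {n} {u : Vector Carrier n} → (∀ i → u i ≈ 0#) → ∀ v → dot u v ≈ 0#
  dot-zeroˡ u≈0 v = sum-zero λ i → trans (*-congʳ (u≈0 i)) (zeroˡ (v i))

  dot-zeroʳ : ∀ {n} (u : Vector Carrier n) {v} → (∀ i → v i ≈ 0#) → dot u v ≈ 0#
  dot-zeroʳ u v≈0 = sum-zero λ i → trans (*-congˡ (v≈0 i)) (zeroʳ (u i))

  dot-comm : ∀ {n} (u v : Vector Carrier n) → dot u v ≈ dot v u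
  dot-comm u v = sum-cong-≋ λ i → *-comm (u i) (v i)

  dot-linear : ∀ {n} (w : Vector Carrier n) a u b v →
               dot w (lincomb a u b v) ≈ a * dot w u + b * dot w v
  dot-linear {n} w a u b v = begin
    dot w (lincomb a u b v)
      ≈⟨ sum-cong-≋ (λ i → rearrange a b (u i) (v i) (w i)) ⟩
    sum (λ i → a * (w i * u i) + b * (w i * v i))
      ≈⟨ ∑-distrib-+ {n} _ _ ⟩
    sum (λ i → a * (w i * u i)) + sum (λ i → b * (w i * v i))
      ≈⟨ +-cong (*-distribˡ-sum {n} a _) (*-distribˡ-sum {n} b _) ⟨
    a * dot w u + b * dot w v ∎

  dot-scale : ∀ {n} (w : Vector Carrier n) a u → dot w (λ i → a * u i) ≈ a * dot w u
  dot-scale {n} w a u = begin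
    dot w (λ i → a * u i)          ≈⟨ sum-cong-≋ (λ i → x∙yz≈y∙xz (w i) a (u i)) ⟩
    sum (λ i → a * (w i * u i))    ≈⟨ *-distribˡ-sum {n} a _ ⟨
    a * dot w u                    ∎

  *ᵛ-cong : ∀ {m n} {X Y : Matrix Carrier m n} {u v} → X ≈ᴹ Y → u ≈ᵛ v → X *ᵛ u ≈ᵛ Y *ᵛ v
  *ᵛ-cong X≈Y u≈v i = dot-cong (X≈Y i) u≈v

  *ᵛ-congʳ : ∀ {m n} (X : Matrix Carrier m n) {u v} → u ≈ᵛ v → X *ᵛ u ≈ᵛ X *ᵛ v
  *ᵛ-congʳ X = *ᵛ-cong (λ _ _ → ≈-refl)

  *ᵛ-linear : ∀ {m n} (X : Matrix Carrier m n) a u b v →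
              X *ᵛ lincomb a u b v ≈ᵛ lincomb a (X *ᵛ u) b (X *ᵛ v)
  *ᵛ-linear X a u b v i = dot-linear (X i) a u b v

  *ᵛ-scale : ∀ {m n} (X : Matrix Carrier m n) a u i → (X *ᵛ (λ j → a * u j)) i ≈ a * (X *ᵛ u) i
  *ᵛ-scale X a u i = dot-scale (X i) a u

  *ᵛ-zero : ∀ {m n} (X : Matrix Carrier m n) {v} → (∀ i → v i ≈ 0#) → ∀ i → (X *ᵛ v) i ≈ 0#
  *ᵛ-zero X v≈0 i = dot-zeroʳ (X i) v≈0

  dot-adjoint : ∀ {m n} (u : Vector Carrier m) (X : Matrix Carrier m n) v →
                dot u (X *ᵛ v) ≈ dot (X ᵀ *ᵛ u) v
  dot-adjoint {m} {n} u X v = begin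
    sum (λ i → u i * sum (λ j → X i j * v j))
      ≈⟨ sum-cong-≋ (λ i → *-distribˡ-sum {n} (u i) _) ⟩
    sum (λ i → sum (λ j → u i * (X i j * v j)))
      ≈⟨ ∑-comm {m} {n} _ ⟩
    sum (λ j → sum (λ i → u i * (X i j * v j)))
      ≈⟨ sum-cong-≋ (λ j → sum-cong-≋ (λ i → x∙yz≈yx∙z (u i) (X i j) (v j))) ⟩
    sum (λ j → sum (λ i → X i j * u i * v j))
      ≈⟨ sum-cong-≋ (λ j → *-distribʳ-sum {m} (v j) _) ⟨
    sum (λ j → sum (λ i → X i j * u i) * v j) ∎

  *ᴹ-*ᵛ : ∀ {l m n} (X : Matrix Carrier l m) (Y : Matrix Carrier m n) v →
          (X *ᴹ Y) *ᵛ v ≈ᵛ X *ᵛ (Y *ᵛ v)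
  *ᴹ-*ᵛ X Y v i = sym (begin
    dot (X i) (Y *ᵛ v)     ≈⟨ dot-adjoint (X i) Y v ⟩
    dot (Y ᵀ *ᵛ X i) v     ≈⟨ dot-cong (λ k → dot-comm ((Y ᵀ) k) (X i)) (λ _ → ≈-refl) ⟩
    dot ((X *ᴹ Y) i) v     ∎)

  diag-dot : ∀ {n} (d : Vector Carrier n) v i → dot (diag d i) v ≈ d i * v i
  diag-dot {suc n} d v zero    = trans (+-congˡ (dot-zeroˡ {n} (λ _ → ≈-refl) (λ k → v (suc k)))) (+-identityʳ _)
  diag-dot d v (suc i) = trans (+-congʳ (zeroˡ _))
                          (trans (+-identityˡ _) (diag-dot (λ k → d (suc k)) (λ k → v (suc k)) i))

  Id-*ᵛ : ∀ {n} (v : Vector Carrier n) → Id *ᵛ v ≈ᵛ v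
  Id-*ᵛ v i = trans (diag-dot ones v i) (*-identityˡ (v i))

  *ᵛ-Id : ∀ {m n} (X : Matrix Carrier m n) j i → (X *ᵛ Id j) i ≈ X i j
  *ᵛ-Id X j i = trans (dot-comm (X i) (Id j)) (Id-*ᵛ (X i) j)

  inverse-*ᵛ : ∀ {n} {X Y : Matrix Carrier n n} → X *ᴹ Y ≈ᴹ Id → ∀ v → X *ᵛ (Y *ᵛ v) ≈ᵛ v
  inverse-*ᵛ {X = X} {Y} XY v i =
    trans (sym (*ᴹ-*ᵛ X Y v i)) (trans (*ᵛ-cong XY (λ _ → ≈-refl) i) (Id-*ᵛ v i))

  -- The coefficients of a polynomial are listed from the constant one upwards,
  -- and act f M u is f(M) u, evaluated by Horner's rule.
  act : ∀ {n} → List Carrier → Matrix Carrier n n → Vector Carrier n → Vector Carrier n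
  act f M u = List.foldr (λ c w i → c * u i + (M *ᵛ w) i) (λ _ → 0#) f

  act-cong : ∀ {n f g} {M N : Matrix Carrier n n} {u v} →
             Pointwise _≈_ f g → M ≈ᴹ N → u ≈ᵛ v → act f M u ≈ᵛ act g N v
  act-cong []          M≈N u≈v i = ≈-refl
  act-cong (c≈d ∷ f≈g) M≈N u≈v i =
    +-cong (*-cong c≈d (u≈v i)) (*ᵛ-cong M≈N (act-cong f≈g M≈N u≈v) i)

  act-congʳ : ∀ {n} f (M : Matrix Carrier n n) {u v} → u ≈ᵛ v → act f M u ≈ᵛ act f M v
  act-congʳ []      M u≈v i = ≈-refl
  act-congʳ (c ∷ f) M u≈v i = +-cong (*-congˡ (u≈v i)) (*ᵛ-congʳ M (act-congʳ f M u≈v) i)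

  act-linear : ∀ {n} f (M : Matrix Carrier n n) a u b v →
               act f M (lincomb a u b v) ≈ᵛ lincomb a (act f M u) b (act f M v)
  act-linear []      M a u b v i = sym (trans (+-cong (zeroʳ a) (zeroʳ b)) (+-identityʳ 0#))
  act-linear (c ∷ f) M a u b v i = begin
    c * (a * u i + b * v i) + (M *ᵛ act f M (lincomb a u b v)) i
      ≈⟨ +-congˡ (*ᵛ-congʳ M (act-linear f M a u b v) i) ⟩
    c * (a * u i + b * v i) + (M *ᵛ lincomb a (act f M u) b (act f M v)) i
      ≈⟨ +-congˡ (*ᵛ-linear M a _ b _ i) ⟩
    c * (a * u i + b * v i) + (a * (M *ᵛ act f M u) i + b * (M *ᵛ act f M v) i)
      ≈⟨ horner-step a b c (u i) (v i) _ _ ⟩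
    a * act (c ∷ f) M u i + b * act (c ∷ f) M v i ∎

  act-intertwine : ∀ {m n} f (M : Matrix Carrier n n) (N : Matrix Carrier m m) (L : Matrix Carrier m n) →
                   (∀ v → L *ᵛ (M *ᵛ v) ≈ᵛ N *ᵛ (L *ᵛ v)) →
                   ∀ u → L *ᵛ act f M u ≈ᵛ act f N (L *ᵛ u)
  act-intertwine []      M N L LM≈NL u i = *ᵛ-zero L (λ _ → ≈-refl) i
  act-intertwine (c ∷ f) M N L LM≈NL u i = begin
    (L *ᵛ act (c ∷ f) M u) i
      ≈⟨ *ᵛ-congʳ L (λ k → +-congˡ (sym (*-identityˡ _))) i ⟩
    (L *ᵛ lincomb c u 1# (M *ᵛ act f M u)) i
      ≈⟨ *ᵛ-linear L c u 1# _ i ⟩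
    c * (L *ᵛ u) i + 1# * (L *ᵛ (M *ᵛ act f M u)) i
      ≈⟨ +-congˡ (trans (*-identityˡ _) (LM≈NL _ i)) ⟩
    c * (L *ᵛ u) i + (N *ᵛ (L *ᵛ act f M u)) i
      ≈⟨ +-congˡ (*ᵛ-congʳ N (act-intertwine f M N L LM≈NL u) i) ⟩
    act (c ∷ f) N (L *ᵛ u) i ∎

  act-comm : ∀ {n} f (M : Matrix Carrier n n) u → M *ᵛ act f M u ≈ᵛ act f M (M *ᵛ u)
  act-comm f M = act-intertwine f M M M (λ _ _ → ≈-refl)

  act-adjoint : ∀ {n} f {M : Matrix Carrier n n} → M ≈ᴹ M ᵀ →
                ∀ u v → dot u (act f M v) ≈ dot (act f M u) v
  act-adjoint []      M≈Mᵀ u v = trans (dot-zeroʳ u (λ _ → ≈-refl)) (sym (dot-zeroˡ (λ _ → ≈-refl) v))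
  act-adjoint (c ∷ f) {M} M≈Mᵀ u v = begin
    dot u (act (c ∷ f) M v)
      ≈⟨ dot-cong {u = u} (λ _ → ≈-refl) (λ k → +-congˡ (sym (*-identityˡ _))) ⟩
    dot u (lincomb c v 1# (M *ᵛ act f M v))
      ≈⟨ dot-linear u c v 1# _ ⟩
    c * dot u v + 1# * dot u (M *ᵛ act f M v)
      ≈⟨ +-cong (*-congˡ (dot-comm u v)) (*-congˡ move) ⟩
    c * dot v u + 1# * dot v (M *ᵛ act f M u)
      ≈⟨ dot-linear v c u 1# _ ⟨
    dot v (lincomb c u 1# (M *ᵛ act f M u))
      ≈⟨ dot-cong {u = v} (λ _ → ≈-refl) (λ k → +-congˡ (*-identityˡ _)) ⟩
    dot v (act (c ∷ f) M u)
      ≈⟨ dot-comm v _ ⟩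
    dot (act (c ∷ f) M u) v ∎
    where
    move : dot u (M *ᵛ act f M v) ≈ dot v (M *ᵛ act f M u)
    move = begin
      dot u (M *ᵛ act f M v)     ≈⟨ dot-adjoint u M _ ⟩
      dot (M ᵀ *ᵛ u) (act f M v)
        ≈⟨ dot-cong (*ᵛ-cong (λ i j → sym (M≈Mᵀ i j)) (λ _ → ≈-refl)) (λ _ → ≈-refl) ⟩
      dot (M *ᵛ u) (act f M v)   ≈⟨ act-adjoint f M≈Mᵀ (M *ᵛ u) v ⟩
      dot (act f M (M *ᵛ u)) v   ≈⟨ dot-cong (λ i → sym (act-comm f M u i)) (λ _ → ≈-refl) ⟩
      dot (M *ᵛ act f M u) v     ≈⟨ dot-comm _ v ⟩
      dot v (M *ᵛ act f M u)     ∎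

  Id-sym : ∀ {n} (i j : Fin n) → Id i j ≈ Id j i
  Id-sym zero    zero    = ≈-refl
  Id-sym zero    (suc j) = ≈-refl
  Id-sym (suc i) zero    = ≈-refl
  Id-sym (suc i) (suc j) = Id-sym i j

  -- `act` never forms the matrix f(M). Its columns are recovered as the images of the basis
  -- vectors, so that vanishing or divisibility of f(M) can be tested on these.
  act-matrix : ∀ {n} f (M : Matrix Carrier n n) u i → act f M u i ≈ dot (λ j → act f M (Id j) i) u
  act-matrix     []      M u i = sym (dot-zeroˡ (λ _ → ≈-refl) u)
  act-matrix {n} (c ∷ f) M u i = sym (begin
    dot (λ j → act (c ∷ f) M (Id j) i) u
      ≈⟨ dot-comm _ u ⟩
    dot u (λ j → c * Id j i + (M *ᵛ T j) i)
      ≈⟨ dot-cong {u = u} (λ _ → ≈-refl) (λ j → +-cong (*-congˡ (Id-sym j i))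
           (trans (dot-comm (M i) (T j)) (sym (*-identityˡ _)))) ⟩
    dot u (lincomb c (Id i) 1# (T *ᵛ M i))
      ≈⟨ dot-linear u c (Id i) 1# (T *ᵛ M i) ⟩
    c * dot u (Id i) + 1# * dot u (T *ᵛ M i)
      ≈⟨ +-cong (*-congˡ (trans (dot-comm u (Id i)) (Id-*ᵛ u i)))
                (trans (*-identityˡ _) (dot-adjoint u T (M i))) ⟩
    c * u i + dot (T ᵀ *ᵛ u) (M i)
      ≈⟨ +-congˡ (trans (dot-comm _ (M i))
           (dot-cong {u = M i} (λ _ → ≈-refl) (λ k → sym (act-matrix f M u k)))) ⟩
    act (c ∷ f) M u i ∎)
    where
    T : Matrix Carrier n n
    T j = act f M (Id j)

  Id-≡ : ∀ {n} (i : Fin n) → Id i i ≈ 1#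
  Id-≡ zero    = ≈-refl
  Id-≡ (suc i) = Id-≡ i

  Id-≢ : ∀ {n} {i j : Fin n} → i ≢ j → Id i j ≈ 0#
  Id-≢ {i = zero}  {zero}  i≢j = contradiction refl i≢j
  Id-≢ {i = zero}  {suc j} i≢j = ≈-refl
  Id-≢ {i = suc i} {zero}  i≢j = ≈-refl
  Id-≢ {i = suc i} {suc j} i≢j = Id-≢ λ i≡j → i≢j (≡.cong suc i≡j)

-- Kernels and rank over an integral domain

-- Weaker than a field on purpose: for ℤ/p the absence of zero divisors is Euclid's lemma, and the
-- elimination below is fraction-free. Deciding x ≈ 0 is what makes the search for a pivot possible.
record IsIntegralDomain {c ℓ} (R : CommutativeRing c ℓ) : Set (c ⊔ ℓ) where
  open CommutativeRing R using (Carrier; _≈_; _*_; 0#; 1#)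
  field
    zero?            : ∀ x → Dec (x ≈ 0#)
    no-zero-divisors : ∀ x y → x * y ≈ 0# → x ≈ 0# ⊎ y ≈ 0#
    1≉0              : ¬ (1# ≈ 0#)

module IntegralDomain {c ℓ} (R : CommutativeRing c ℓ) (isIntegralDomain : IsIntegralDomain R) where
  open IsIntegralDomain isIntegralDomain
  open CommutativeRing R hiding (zero; refl; ring)
  open CommutativeRing R using () renaming (refl to ≈-refl)
  open import Algebra.Properties.Ring (CommutativeRing.ring R) using (-‿distribˡ-*; -‿distribʳ-*)
  open import Algebra.Properties.CommutativeSemigroup *-commutativeSemigroup
    using (x∙yz≈y∙xz)
  open MatrixAlgebra R
  open LinearAlgebra R
  open import Relation.Binary.Reasoning.Setoid setoid

  Zero : ∀ {n} → Vector Carrier n → Set ℓ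
  Zero v = ∀ i → v i ≈ 0#

  Nonzero : ∀ {n} → Vector Carrier n → Set ℓ
  Nonzero v = ∃[ i ] ¬ (v i ≈ 0#)

  cancel-nonzero : ∀ {x y} → ¬ (x ≈ 0#) → x * y ≈ 0# → y ≈ 0#
  cancel-nonzero {x} {y} x≉0 xy≈0 with no-zero-divisors x y xy≈0
  ... | inj₁ x≈0 = contradiction x≈0 x≉0
  ... | inj₂ y≈0 = y≈0

  summand-zero : ∀ {x y} → x + y ≈ 0# → x ≈ 0# → y ≈ 0#
  summand-zero {x} {y} x+y≈0 x≈0 = trans (sym (trans (+-congʳ x≈0) (+-identityˡ y))) x+y≈0

  difference-zero : ∀ {x z} → x + - z ≈ 0# → x ≈ z
  difference-zero {x} {z} x-z≈0 = begin
    x              ≈⟨ +-identityʳ x ⟨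
    x + 0#         ≈⟨ +-congˡ (-‿inverseˡ z) ⟨
    x + (- z + z)  ≈⟨ +-assoc x (- z) z ⟨
    x + - z + z    ≈⟨ +-congʳ x-z≈0 ⟩
    0# + z         ≈⟨ +-identityˡ z ⟩
    z              ∎

  cancelˡ : ∀ {x y z} → ¬ (x ≈ 0#) → x * y ≈ x * z → y ≈ z
  cancelˡ {x} {y} {z} x≉0 xy≈xz = difference-zero (cancel-nonzero x≉0 (begin
    x * (y + - z)      ≈⟨ distribˡ x y (- z) ⟩
    x * y + x * - z    ≈⟨ +-cong xy≈xz (sym (-‿distribʳ-* x z)) ⟩
    x * z + - (x * z)  ≈⟨ -‿inverseʳ (x * z) ⟩
    0#                 ∎))

  -- Fraction-free elimination: a nonzero pivot clears its column, and the other
  -- rows are solved recursively.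
  kernel : ∀ {t n} → t ℕ.< n → (X : Matrix Carrier t n) → Σ[ a ∈ Vector Carrier n ] Nonzero a × Zero (X *ᵛ a)
  kernel {zero}  {suc n} _ X = Id zero , (zero , 1≉0) , λ ()
  kernel {suc t} {suc n} (ℕ.s≤s t<n) X with any? (λ i → ¬? (zero? (X i zero)))
  ... | no  column≈0 = Id zero , (zero , 1≉0) , λ i →
          trans (*ᵛ-Id X zero i) (decidable-stable (zero? (X i zero)) (λ Xi0≉0 → column≈0 (i , Xi0≉0)))
  ... | yes (s , pivot≉0) = a , (suc (proj₁ a′≉0) , λ z → proj₂ a′≉0 (cancel-nonzero pivot≉0 z)) , X*a≈0
    where
    pivot = X s zero
    row : Fin (suc t) → Vector Carrier n
    row i k = X i (suc k)
    X′ : Matrix Carrier t n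
    X′ r = lincomb pivot (row (punchIn s r)) (- X (punchIn s r) zero) (row s)
    solution = kernel t<n X′
    a′ = proj₁ solution
    a′≉0 = proj₁ (proj₂ solution)
    -- Scaling the recursive solution by the pivot lets the equation of row `s` be solved for the
    -- first coordinate without division.
    a : Vector Carrier (suc n)
    a zero    = - dot (row s) a′
    a (suc k) = pivot * a′ k
    expand : ∀ i → (X *ᵛ a) i ≈ X i zero * - dot (row s) a′ + pivot * dot (row i) a′
    expand i = +-congˡ (dot-scale (row i) pivot a′)
    X*a≈0 : Zero (X *ᵛ a)
    X*a≈0 i with s ≟ i
    ... | yes refl = begin
      (X *ᵛ a) s                                        ≈⟨ expand s ⟩
      pivot * - dot (row s) a′ + pivot * dot (row s) a′ ≈⟨ distribˡ pivot _ _ ⟨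
      pivot * (- dot (row s) a′ + dot (row s) a′)       ≈⟨ *-congˡ (-‿inverseˡ _) ⟩
      pivot * 0#                                        ≈⟨ zeroʳ pivot ⟩
      0#                                                ∎
    ... | no s≢i with punchOut s≢i | punchIn-punchOut s≢i
    ...   | r | refl = begin
      (X *ᵛ a) i                                          ≈⟨ expand i ⟩
      X i zero * - dot (row s) a′ + pivot * dot (row i) a′ ≈⟨ +-congʳ (-‿distribʳ-* _ _) ⟨
      - (X i zero * dot (row s) a′) + pivot * dot (row i) a′ ≈⟨ +-congʳ (-‿distribˡ-* _ _) ⟩
      - X i zero * dot (row s) a′ + pivot * dot (row i) a′ ≈⟨ +-comm _ _ ⟩
      pivot * dot (row i) a′ + - X i zero * dot (row s) a′
        ≈⟨ +-cong (*-congˡ (dot-comm (row i) a′)) (*-congˡ (dot-comm (row s) a′)) ⟩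
      pivot * dot a′ (row i) + - X i zero * dot a′ (row s)
        ≈⟨ dot-linear a′ pivot (row i) _ (row s) ⟨
      dot a′ (X′ r)                                       ≈⟨ dot-comm a′ (X′ r) ⟩
      (X′ *ᵛ a′) r                                        ≈⟨ proj₂ (proj₂ solution) r ⟩
      0#                                                  ∎

  InSpan-trans : ∀ {m r s} {b : Vector (Vector Carrier m) r} {c : Vector (Vector Carrier m) s} {v} →
                 (∀ k → InSpan c (b k)) → InSpan b v → InSpan c v
  InSpan-trans {b = b} {c} {v} b∈c (a , ab≈v) = (C ᵀ) *ᵛ a , λ i → begin
    dot ((C ᵀ) *ᵛ a) (λ k → c k i)   ≈⟨ dot-adjoint a C (λ k → c k i) ⟨
    dot a (C *ᵛ (λ k → c k i))       ≈⟨ dot-cong {u = a} (λ _ → ≈-refl) (λ k → proj₂ (b∈c k) i) ⟩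
    dot a (λ k → b k i)              ≈⟨ ab≈v i ⟩
    v i                              ∎
    where
    C : Matrix Carrier _ _
    C k = proj₁ (b∈c k)

  -- A relation `s` among the c, put beside the coordinates of the r vectors b, gives r + 1 vectors
  -- in dimension r, hence a dependency `a`. Evaluated on c it becomes a relation among the b, so
  -- only the coefficient of `s` can survive, and it forces `s` to vanish.
  steinitz : ∀ {m r} {b c : Vector (Vector Carrier m) r} → LinearlyIndependent b →
             (∀ k → InSpan c (b k)) → LinearlyIndependent c
  steinitz {m} {r} {b} {c} b-indep b∈c s sc≈0 i = cancel-nonzero a₀≉0 a₀sᵢ≈0
    where
    C : Matrix Carrier r r
    C k = proj₁ (b∈c k)
    Y : Matrix Carrier r (suc r)
    Y i zero    = s i
    Y i (suc k) = C k i
    solution = kernel (ℕ.n<1+n r) Y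
    a = proj₁ solution
    a⁺ : Vector Carrier r
    a⁺ k = a (suc k)
    Ya≈0 : ∀ i → s i * a zero + ((C ᵀ) *ᵛ a⁺) i ≈ 0#
    Ya≈0 = proj₂ (proj₂ solution)
    a⁺≈0 : Zero a⁺
    a⁺≈0 = b-indep a⁺ λ j → let cⱼ = λ k → c k j in begin
      dot a⁺ (λ k → b k j)        ≈⟨ dot-cong {u = a⁺} (λ _ → ≈-refl) (λ k → proj₂ (b∈c k) j) ⟨
      dot a⁺ (C *ᵛ cⱼ)            ≈⟨ dot-adjoint a⁺ C cⱼ ⟩
      dot ((C ᵀ) *ᵛ a⁺) cⱼ        ≈⟨ dot-comm _ cⱼ ⟩
      dot cⱼ ((C ᵀ) *ᵛ a⁺)
        ≈⟨ trans (+-congʳ (trans (*-congˡ (trans (dot-comm cⱼ s) (sc≈0 j))) (zeroʳ _))) (+-identityˡ _) ⟨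
      a zero * dot cⱼ s + dot cⱼ ((C ᵀ) *ᵛ a⁺)        ≈⟨ +-congˡ (*-identityˡ _) ⟨
      a zero * dot cⱼ s + 1# * dot cⱼ ((C ᵀ) *ᵛ a⁺)   ≈⟨ dot-linear cⱼ (a zero) s 1# _ ⟨
      dot cⱼ (lincomb (a zero) s 1# ((C ᵀ) *ᵛ a⁺))
        ≈⟨ dot-zeroʳ cⱼ (λ i → trans (+-cong (*-comm _ _) (*-identityˡ _)) (Ya≈0 i)) ⟩
      0#                          ∎
    a₀sᵢ≈0 : a zero * s i ≈ 0#
    a₀sᵢ≈0 = trans (*-comm _ _) (summand-zero (trans (+-comm _ _) (Ya≈0 i)) (dot-zeroʳ (λ k → C k i) a⁺≈0))
    a₀≉0 : ¬ (a zero ≈ 0#)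
    a₀≉0 a₀≈0 with proj₁ (proj₂ solution)
    ... | zero  , nz = nz a₀≈0
    ... | suc k , nz = nz (a⁺≈0 k)

  spanning-independent : ∀ {m n r} {X : Matrix Carrier m n} {c : Vector (Vector Carrier m) r} →
                         HasRank X r → (∀ j → InSpan c ((X ᵀ) j)) → LinearlyIndependent c
  spanning-independent (b , b-indep , b∈X , _) X∈c = steinitz b-indep λ k → InSpan-trans X∈c (b∈X k)

  rank-deficient-kernel : ∀ {m n r} {X : Matrix Carrier m n} → HasRank X r → r ℕ.< n →
                          Σ[ a ∈ Vector Carrier n ] Nonzero a × Zero (X *ᵛ a)
  rank-deficient-kernel {X = X} (b , _ , _ , X∈b) r<n with kernel r<n (C ᵀ)
    where
    C : Matrix Carrier _ _
    C j = proj₁ (X∈b j)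
  ... | a , a≉0 , Ca≈0 = a , a≉0 , λ i → let bᵢ = λ k → b k i in begin
    dot (X i) a                        ≈⟨ dot-comm (X i) a ⟩
    dot a (X i)                        ≈⟨ dot-cong {u = a} (λ _ → ≈-refl) (λ j → proj₂ (X∈b j) i) ⟨
    dot a ((λ j → proj₁ (X∈b j)) *ᵛ bᵢ) ≈⟨ dot-adjoint a (λ j → proj₁ (X∈b j)) bᵢ ⟩
    dot (((λ j → proj₁ (X∈b j)) ᵀ) *ᵛ a) bᵢ ≈⟨ dot-zeroˡ Ca≈0 bᵢ ⟩
    0#                                 ∎

  -- Dropping a row `s` with w s nonzero leaves m equations in m + 1 unknowns; since wᵀX = 0, the
  -- dropped equation follows from the others.
  singular-transpose : ∀ {m} (X : Matrix Carrier (suc m) (suc m)) w → Nonzero w → Zero ((X ᵀ) *ᵛ w) →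
                       Σ[ a ∈ Vector Carrier (suc m) ] Nonzero a × Zero (X *ᵛ a)
  singular-transpose {m} X w (s , wₛ≉0) Xᵀw≈0 with kernel (ℕ.n<1+n m) (λ r → X (punchIn s r))
  ... | a , a≉0 , others≈0 = a , a≉0 , Xa≈0
    where
    open import Algebra.Properties.CommutativeMonoid.Sum +-commutativeMonoid using (sum-remove)
    at-s : (X *ᵛ a) s ≈ 0#
    at-s = cancel-nonzero wₛ≉0 (begin
      w s * (X *ᵛ a) s
        ≈⟨ trans (+-congˡ (dot-zeroʳ (λ r → w (punchIn s r)) others≈0)) (+-identityʳ _) ⟨
      w s * (X *ᵛ a) s + dot (λ r → w (punchIn s r)) (λ r → (X *ᵛ a) (punchIn s r))
                             ≈⟨ sum-remove {m} {s} (λ i → w i * (X *ᵛ a) i) ⟨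
      dot w (X *ᵛ a)         ≈⟨ dot-adjoint w X a ⟩
      dot ((X ᵀ) *ᵛ w) a     ≈⟨ dot-zeroˡ Xᵀw≈0 a ⟩
      0#                     ∎)
    Xa≈0 : Zero (X *ᵛ a)
    Xa≈0 i with s ≟ i
    ... | yes refl = at-s
    ... | no s≢i with punchOut s≢i | punchIn-punchOut s≢i
    ...   | r | refl = others≈0 r

  -- Multiplication by x on polynomials of degree at most m, listed from the constant coefficient
  -- upwards. The top coefficient is lost, so this is faithful only where it vanishes.
  up : ∀ {m} → Vector Carrier (suc m) → Vector Carrier (suc m)
  up h zero    = 0#
  up h (suc i) = h (inject₁ i)

  -- Coefficient i + 1 of x h = μ h says that coefficient i of h is μ times the next one, so
  -- vanishing spreads downwards from the top.
  up-eigenvector : ∀ {m} (h : Vector Carrier (suc m)) μ → h (fromℕ m) ≈ 0# →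
                   (∀ i → up h i ≈ μ * h i) → Zero h
  up-eigenvector h μ hₗ≈0 eigen = >-weakInduction (λ i → h i ≈ 0#) hₗ≈0 λ i hᵢ₊₁≈0 →
    trans (eigen (suc i)) (trans (*-congˡ hᵢ₊₁≈0) (zeroʳ μ))

  IsKrylov : ∀ {m} → Matrix Carrier (suc m) (suc m) → Matrix Carrier (suc m) (suc m) → Set ℓ
  IsKrylov A W = ∀ j → A *ᵛ (W ᵀ) (inject₁ j) ≈ᵛ (W ᵀ) (suc j)

  -- W h is h(A) applied to the first column, so A acts as multiplication by x. The last column has
  -- no successor inside W, whence the condition on the top coefficient.
  krylov-up : ∀ {m} (A W : Matrix Carrier (suc m) (suc m)) → IsKrylov A W →
              ∀ h → h (fromℕ m) ≈ 0# → A *ᵛ (W *ᵛ h) ≈ᵛ W *ᵛ up h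
  krylov-up {m} A W krylov h hₗ≈0 i = begin
    (A *ᵛ (W *ᵛ h)) i        ≈⟨ *ᴹ-*ᵛ A W h i ⟨
    dot ((A *ᴹ W) i) h       ≈⟨ sum-init-last {m} (λ j → (A *ᴹ W) i j * h j) ⟩
    dot (λ j → (A *ᴹ W) i (inject₁ j)) (λ j → h (inject₁ j)) + (A *ᴹ W) i (fromℕ m) * h (fromℕ m)
      ≈⟨ +-cong (dot-cong {v = λ j → h (inject₁ j)} (λ j → krylov j i) (λ _ → ≈-refl))
                (trans (*-congˡ hₗ≈0) (zeroʳ _)) ⟩
    dot (λ j → W i (suc j)) (λ j → h (inject₁ j)) + 0#
      ≈⟨ +-comm _ 0# ⟩
    0# + dot (λ j → W i (suc j)) (λ j → h (inject₁ j))
      ≈⟨ +-congʳ (zeroʳ (W i zero)) ⟨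
    (W *ᵛ up h) i            ∎
    where open import Algebra.Properties.Monoid.Sum +-monoid using (sum-init-last)

  Eigenvector : ∀ {n} → Matrix Carrier n n → Carrier → Vector Carrier n → Set ℓ
  Eigenvector A μ x = ∀ i → (A *ᵛ x) i ≈ μ * x i

  eigenvector-scale : ∀ {n} {A : Matrix Carrier n n} {μ x} a {z} → Eigenvector A μ x →
                      (∀ i → z i ≈ a * x i) → Eigenvector A μ z
  eigenvector-scale {A = A} {μ} {x} a {z} eigen z≈ax i = begin
    (A *ᵛ z) i                ≈⟨ *ᵛ-congʳ A z≈ax i ⟩
    (A *ᵛ (λ j → a * x j)) i  ≈⟨ *ᵛ-scale A a x i ⟩
    a * (A *ᵛ x) i            ≈⟨ *-congˡ (eigen i) ⟩
    a * (μ * x i)             ≈⟨ x∙yz≈y∙xz a μ (x i) ⟩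
    μ * (a * x i)             ≈⟨ *-congˡ (z≈ax i) ⟨
    μ * z i                   ∎

  lincomb-zeroʳ : ∀ {n a b} {u v : Vector Carrier n} → Zero v → ∀ i → lincomb a u b v i ≈ a * u i
  lincomb-zeroʳ v≈0 i = trans (+-congˡ (trans (*-congˡ (v≈0 i)) (zeroʳ _))) (+-identityʳ _)

  lincomb-zeroˡ : ∀ {n a b} {u v : Vector Carrier n} → Zero u → ∀ i → lincomb a u b v i ≈ b * v i
  lincomb-zeroˡ u≈0 i = trans (+-congʳ (trans (*-congˡ (u≈0 i)) (zeroʳ _))) (+-identityˡ _)

  *ᵛ-eigen-up : ∀ {m} (A W : Matrix Carrier (suc m) (suc m)) {μ} → IsKrylov A W →
                ∀ h → h (fromℕ m) ≈ 0# → Eigenvector A μ (W *ᵛ h) →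
                Zero (W *ᵛ lincomb 1# (up h) (- μ) h)
  *ᵛ-eigen-up A W {μ} krylov h hₗ≈0 eigen i = begin
    (W *ᵛ lincomb 1# (up h) (- μ) h) i        ≈⟨ *ᵛ-linear W 1# (up h) (- μ) h i ⟩
    1# * (W *ᵛ up h) i + - μ * (W *ᵛ h) i     ≈⟨ +-congʳ (*-identityˡ _) ⟩
    (W *ᵛ up h) i + - μ * (W *ᵛ h) i          ≈⟨ +-congʳ (krylov-up A W krylov h hₗ≈0 i) ⟨
    (A *ᵛ (W *ᵛ h)) i + - μ * (W *ᵛ h) i      ≈⟨ +-congʳ (eigen i) ⟩
    μ * (W *ᵛ h) i + - μ * (W *ᵛ h) i         ≈⟨ distribʳ _ μ (- μ) ⟨
    (μ + - μ) * (W *ᵛ h) i                    ≈⟨ trans (*-congʳ (-‿inverseʳ μ)) (zeroˡ _) ⟩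
    0#                                        ∎

  column : ∀ {m n} (X : Matrix Carrier m n) (u : Vector Carrier m) j →
           ((X ᵀ) *ᵛ u) j ≈ dot (X *ᵛ Id j) u
  column X u j = dot-cong {v = u} (λ i → sym (*ᵛ-Id X j i)) (λ _ → ≈-refl)

  -- If w = W′v were nonzero, W′ would be singular, say W′v′ = 0, and a combination
  -- h of v and v′ with vanishing top coefficient would have both Wh and W′h
  -- eigenvectors with eigenvalue μ.  Then W and W′ map up h - μ h to 0, so
  -- up h = μ h, which only h = 0 satisfies.
  kernel-transfer :
    ∀ {m} {A B W W′ : Matrix Carrier (suc m) (suc m)} {v y μ} →
    IsKrylov A W → IsKrylov B W′ →
    (∀ a b → dot (W *ᵛ a) (W *ᵛ b) ≈ dot (W′ *ᵛ a) (W′ *ᵛ b)) →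
    Zero (W *ᵛ v) → (∀ g → Zero (W *ᵛ g) → ∃[ α ] (∀ i → g i ≈ α * v i)) →
    Nonzero y → (∀ u → Zero ((W ᵀ) *ᵛ u) → ∃[ κ ] (∀ i → u i ≈ κ * y i)) →
    Eigenvector A μ y →
    (∀ i j → (W′ *ᵛ v) i * (A *ᵛ y) j ≈ (B *ᵛ (W′ *ᵛ v)) i * y j) →
    Zero (W′ *ᵛ v)
  kernel-transfer {m} {A} {B} {W} {W′} {v} {y} {μ} krylov krylov′ gram Wv≈0 kerW (t , yₜ≉0) kerWᵀ eigen intertwine
    with any? (λ i → ¬? (zero? ((W′ *ᵛ v) i)))
  ... | no  w≈0 = λ i → decidable-stable (zero? ((W′ *ᵛ v) i)) (λ wᵢ≉0 → w≈0 (i , wᵢ≉0))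
  ... | yes w≉0 = contradiction w≈0 λ w≈0 → proj₂ w≉0 (w≈0 (proj₁ w≉0))
    where
    w = W′ *ᵛ v
    l = fromℕ m

    -- Compare the columns with index `t`, where y is nonzero, in w (Ay)ᵀ = (Bw) yᵀ.
    eigen′ : Eigenvector B μ w
    eigen′ i = sym (difference-zero (cancel-nonzero yₜ≉0 (begin
      y t * (μ * w i + - (B *ᵛ w) i)         ≈⟨ distribˡ _ _ _ ⟩
      y t * (μ * w i) + y t * - (B *ᵛ w) i   ≈⟨ +-cong swap (sym (-‿distribʳ-* _ _)) ⟩
      w i * (μ * y t) + - (y t * (B *ᵛ w) i)
        ≈⟨ +-cong (*-congˡ (sym (eigen t))) (-‿cong (*-comm _ _)) ⟩
      w i * (A *ᵛ y) t + - ((B *ᵛ w) i * y t) ≈⟨ +-congʳ (intertwine i t) ⟩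
      (B *ᵛ w) i * y t + - ((B *ᵛ w) i * y t) ≈⟨ -‿inverseʳ _ ⟩
      0# ∎)))
      where
      swap : y t * (μ * w i) ≈ w i * (μ * y t)
      swap = trans (*-congˡ (*-comm μ (w i))) (trans (x∙yz≈y∙xz (y t) (w i) μ) (*-congˡ (*-comm (y t) μ)))

    -- W′ᵀW′v = WᵀWv = 0. The same identity read backwards puts W v′ into the kernel of Wᵀ below.
    W′ᵀw≈0 : Zero ((W′ ᵀ) *ᵛ w)
    W′ᵀw≈0 j = trans (column W′ w j) (trans (sym (gram (Id j) v)) (dot-zeroʳ (W *ᵛ Id j) Wv≈0))

    singular = singular-transpose W′ w w≉0 W′ᵀw≈0
    v′ = proj₁ singular
    W′v′≈0 : Zero (W′ *ᵛ v′)
    W′v′≈0 = proj₂ (proj₂ singular)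

    Wv′∈⟨y⟩ : ∃[ κ ] (∀ i → (W *ᵛ v′) i ≈ κ * y i)
    Wv′∈⟨y⟩ = kerWᵀ (W *ᵛ v′) λ j →
      trans (column W (W *ᵛ v′) j) (trans (gram (Id j) v′) (dot-zeroʳ (W′ *ᵛ Id j) W′v′≈0))
    κ = proj₁ Wv′∈⟨y⟩

    h : Vector Carrier (suc m)
    h = lincomb (v l) v′ (- v′ l) v

    hₗ≈0 : h l ≈ 0#
    hₗ≈0 = trans (+-cong (*-comm _ _) (sym (-‿distribˡ-* _ _))) (-‿inverseʳ _)

    Wh : ∀ i → (W *ᵛ h) i ≈ (v l * κ) * y i
    Wh i = begin
      (W *ᵛ h) i            ≈⟨ *ᵛ-linear W (v l) v′ (- v′ l) v i ⟩
      lincomb (v l) (W *ᵛ v′) (- v′ l) (W *ᵛ v) i ≈⟨ lincomb-zeroʳ {u = W *ᵛ v′} Wv≈0 i ⟩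
      v l * (W *ᵛ v′) i     ≈⟨ *-congˡ (proj₂ Wv′∈⟨y⟩ i) ⟩
      v l * (κ * y i)       ≈⟨ *-assoc _ _ _ ⟨
      (v l * κ) * y i       ∎

    W′h : ∀ i → (W′ *ᵛ h) i ≈ - v′ l * w i
    W′h i = trans (*ᵛ-linear W′ (v l) v′ (- v′ l) v i) (lincomb-zeroˡ {v = w} W′v′≈0 i)

    h≈0 : Zero h
    h≈0 = up-eigenvector h μ hₗ≈0 λ i → up-h i
      where
      g = lincomb 1# (up h) (- μ) h
      g∈⟨v⟩ : ∃[ α ] (∀ i → g i ≈ α * v i)
      g∈⟨v⟩ = kerW g (*ᵛ-eigen-up A W krylov h hₗ≈0 (eigenvector-scale {A = A} (v l * κ) eigen Wh))
      α = proj₁ g∈⟨v⟩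
      -- W′g = α w vanishes as well, because W′ also sends h to an eigenvector for μ, whereas w is
      -- nonzero.
      α≈0 : α ≈ 0#
      α≈0 = cancel-nonzero (proj₂ w≉0) (begin
        w s * α                         ≈⟨ *-comm _ _ ⟩
        α * w s                         ≈⟨ *ᵛ-scale W′ α v s ⟨
        (W′ *ᵛ (λ i → α * v i)) s       ≈⟨ *ᵛ-congʳ W′ (proj₂ g∈⟨v⟩) s ⟨
        (W′ *ᵛ g) s
          ≈⟨ *ᵛ-eigen-up B W′ krylov′ h hₗ≈0 (eigenvector-scale {A = B} (- v′ l) eigen′ W′h) s ⟩
        0#                              ∎)
        where s = proj₁ w≉0
      up-h : ∀ i → up h i ≈ μ * h i
      up-h i = begin
        up h i                          ≈⟨ +-identityʳ _ ⟨
        up h i + 0#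
          ≈⟨ +-cong (*-identityˡ _) (trans (*-congʳ (-‿inverseˡ μ)) (zeroˡ (h i))) ⟨
        1# * up h i + (- μ + μ) * h i   ≈⟨ +-congˡ (distribʳ (h i) (- μ) μ) ⟩
        1# * up h i + (- μ * h i + μ * h i) ≈⟨ +-assoc _ _ _ ⟨
        g i + μ * h i
          ≈⟨ +-congʳ (trans (proj₂ g∈⟨v⟩ i) (trans (*-congʳ α≈0) (zeroˡ _))) ⟩
        0# + μ * h i                    ≈⟨ +-identityˡ _ ⟩
        μ * h i                         ∎

    -- As h = 0 and w is nonzero, `W′h` kills the top coefficient of v′. Then h is the top
    -- coefficient of v times v′, and v′ being nonzero kills that one too. So x v stays in ker W, is
    -- a multiple of v, and v = 0 follows.
    v′ₗ≈0 : - v′ l ≈ 0#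
    v′ₗ≈0 = cancel-nonzero (proj₂ w≉0) (trans (*-comm _ _)
      (trans (sym (W′h (proj₁ w≉0))) (*ᵛ-zero W′ h≈0 (proj₁ w≉0))))

    vₗ≈0 : v l ≈ 0#
    vₗ≈0 = cancel-nonzero (proj₂ v′≉0) (trans (*-comm _ _) (trans
      (sym (trans (+-congˡ (trans (*-congʳ v′ₗ≈0) (zeroˡ _))) (+-identityʳ _))) (h≈0 (proj₁ v′≉0))))
      where v′≉0 = proj₁ (proj₂ singular)

    w≈0 : Zero w
    w≈0 = *ᵛ-zero W′ (up-eigenvector v (proj₁ upv∈⟨v⟩) vₗ≈0 (proj₂ upv∈⟨v⟩))
      where
      upv∈⟨v⟩ : ∃[ α ] (∀ i → up v i ≈ α * v i)
      upv∈⟨v⟩ = kerW (up v) λ i → trans (sym (krylov-up A W krylov v vₗ≈0 i)) (*ᵛ-zero A Wv≈0 i)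

-- Krylov matrices and monic annihilators

module Orbits {c ℓ} (R : CommutativeRing c ℓ) where
  open CommutativeRing R hiding (zero; refl; ring)
  open CommutativeRing R using () renaming (refl to ≈-refl)
  open MatrixAlgebra R
  open LinearAlgebra R
  open import Algebra.Properties.Monoid.Sum +-monoid using (sum-init-last)
  open import Relation.Binary.Reasoning.Setoid setoid

  IsOrbit : ∀ {n} → Matrix Carrier n n → (ℕ → Vector Carrier n) → Set ℓ
  IsOrbit M a = ∀ k → a (suc k) ≈ᵛ M *ᵛ a k

  combination : ∀ {r n} → Vector Carrier r → (ℕ → Vector Carrier n) → Vector Carrier n
  combination s a = linearCombination s (λ j → a (toℕ j))

  *ᵛ-combination : ∀ {n r} {M : Matrix Carrier n n} {a} → IsOrbit M a → ∀ (s : Vector Carrier r) →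
                   M *ᵛ combination s a ≈ᵛ combination s (λ k → a (suc k))
  *ᵛ-combination {n} {r} {M} {a} orbit s i = begin
    (M *ᵛ combination s a) i     ≈⟨ *ᵛ-congʳ M (λ k → dot-comm s (X k)) i ⟩
    (M *ᵛ (X *ᵛ s)) i            ≈⟨ *ᴹ-*ᵛ M X s i ⟨
    dot ((M *ᴹ X) i) s           ≈⟨ dot-comm _ s ⟩
    dot s ((M *ᴹ X) i)           ≈⟨ dot-cong {u = s} (λ _ → ≈-refl) (λ j → sym (orbit (toℕ j) i)) ⟩
    combination s (λ k → a (suc k)) i ∎
    where
    X : Matrix Carrier n r
    X k j = a (toℕ j) k

  data Monic : ℕ → List Carrier → Set (c ⊔ ℓ) where
    one  : ∀ {c} → c ≈ 1# → Monic 0 (c ∷ [])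
    cons : ∀ {r c f} → Monic r f → Monic (suc r) (c ∷ f)

  lower : ∀ {r f} → Monic r f → Vector Carrier r
  lower (cons {c = c} monic) zero    = c
  lower (cons monic)         (suc i) = lower monic i

  act-monic : ∀ {n r f} (monic : Monic r f) {M : Matrix Carrier n n} {a} → IsOrbit M a →
              ∀ i → act f M (a 0) i ≈ combination (lower monic) a i + a r i
  act-monic (one c≈1) {M} {a} orbit i = begin
    _ * a 0 i + (M *ᵛ (λ _ → 0#)) i
      ≈⟨ +-cong (trans (*-congʳ c≈1) (*-identityˡ _)) (*ᵛ-zero M (λ _ → ≈-refl) i) ⟩
    a 0 i + 0#                       ≈⟨ +-comm _ _ ⟩
    0# + a 0 i                       ∎
  act-monic {r = suc r} (cons {c = c} {f} monic) {M} {a} orbit i = begin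
    c * a 0 i + (M *ᵛ act f M (a 0)) i
      ≈⟨ +-congˡ (*ᵛ-congʳ M (λ k → trans (act-monic monic orbit k)
           (+-cong (sym (*-identityˡ _)) (sym (*-identityˡ _)))) i) ⟩
    c * a 0 i + (M *ᵛ lincomb 1# (combination q a) 1# (a r)) i
      ≈⟨ +-congˡ (*ᵛ-linear M 1# _ 1# (a r) i) ⟩
    c * a 0 i + (1# * (M *ᵛ combination q a) i + 1# * (M *ᵛ a r) i)
      ≈⟨ +-congˡ (+-cong (trans (*-identityˡ _) (*ᵛ-combination orbit q i))
                         (trans (*-identityˡ _) (sym (orbit r i)))) ⟩
    c * a 0 i + (combination q (λ k → a (suc k)) i + a (suc r) i)
      ≈⟨ +-assoc _ _ _ ⟨
    c * a 0 i + combination q (λ k → a (suc k)) i + a (suc r) i ∎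
    where q = lower monic

  private
    prepend : ∀ {r} → Carrier → Vector Carrier r → Vector Carrier (suc r)
    prepend c s zero    = c
    prepend c s (suc i) = s i

  -- The remainder of c + x s(x) modulo the monic polynomial.
  remainder-step : ∀ {r f} → Monic r f → Carrier → Vector Carrier r → Vector Carrier r
  remainder-step {r} monic c s = lincomb 1# (λ i → t (inject₁ i)) (- t (fromℕ r)) (lower monic)
    where t = prepend c s

  -- Subtracting `top` times the monic polynomial removes the term of degree r and does not change
  -- the value, because the polynomial annihilates `a 0`.
  combination-remainder-step :
    ∀ {n r f} (monic : Monic r f) {M : Matrix Carrier n n} {a} → IsOrbit M a →
    (∀ i → act f M (a 0) i ≈ 0#) → ∀ c (s : Vector Carrier r) i →
    combination (remainder-step monic c s) a i ≈ c * a 0 i + (M *ᵛ combination s a) i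
  combination-remainder-step {n} {r} monic {M} {a} orbit fa≈0 c s i = begin
    dot (remainder-step monic c s) aᵢ
      ≈⟨ dot-comm _ aᵢ ⟩
    dot aᵢ (lincomb 1# (λ j → t (inject₁ j)) (- top) q)
      ≈⟨ dot-linear aᵢ 1# _ (- top) q ⟩
    1# * dot aᵢ (λ j → t (inject₁ j)) + - top * dot aᵢ q
      ≈⟨ +-cong (trans (*-identityˡ _) (dot-comm aᵢ _)) (*-congˡ (dot-comm aᵢ q)) ⟩
    dot (λ j → t (inject₁ j)) aᵢ + - top * combination q a i
      ≈⟨ +-cong (dot-cong {u = λ j → t (inject₁ j)} (λ _ → ≈-refl) (λ j → reflexive (≡.cong (λ k → a k i) (≡.sym (toℕ-inject₁ j))))) reduce ⟩
    dot (λ j → t (inject₁ j)) (λ j → a (toℕ (inject₁ j)) i) + top * a (toℕ (fromℕ r)) i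
      ≈⟨ sum-init-last {r} (λ j → t j * a (toℕ j) i) ⟨
    c * a 0 i + combination s (λ k → a (suc k)) i
      ≈⟨ +-congˡ (*ᵛ-combination orbit s i) ⟨
    c * a 0 i + (M *ᵛ combination s a) i ∎
    where
    t = prepend c s
    top = t (fromℕ r)
    q = lower monic
    aᵢ : Vector Carrier r
    aᵢ j = a (toℕ j) i
    reduce : - top * combination q a i ≈ top * a (toℕ (fromℕ r)) i
    reduce = begin
      - top * combination q a i                     ≈⟨ +-identityʳ _ ⟨
      - top * combination q a i + 0#                ≈⟨ +-congˡ (zeroʳ top) ⟨
      - top * combination q a i + top * 0#
        ≈⟨ +-congˡ (*-congˡ (trans (sym (act-monic monic orbit i)) (fa≈0 i))) ⟨
      - top * combination q a i + top * (combination q a i + a r i)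
        ≈⟨ +-congˡ (distribˡ top _ _) ⟩
      - top * combination q a i + (top * combination q a i + top * a r i)
        ≈⟨ +-assoc _ _ _ ⟨
      - top * combination q a i + top * combination q a i + top * a r i
        ≈⟨ +-congʳ (trans (sym (distribʳ _ (- top) top)) (trans (*-congʳ (-‿inverseˡ top)) (zeroˡ _))) ⟩
      0# + top * a r i                              ≈⟨ +-identityˡ _ ⟩
      top * a r i
        ≈⟨ *-congˡ (reflexive (≡.cong (λ k → a k i) (≡.sym (toℕ-fromℕ r)))) ⟩
      top * a (toℕ (fromℕ r)) i                     ∎

  -- The remainder of the k-th power of x. The constant 1 passes through a reduction step too, so
  -- degree r = 0 needs no separate case.
  power-remainder : ∀ {r f} → Monic r f → ℕ → Vector Carrier r
  power-remainder monic zero    = remainder-step monic 1# (λ _ → 0#)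
  power-remainder monic (suc k) = remainder-step monic 0# (power-remainder monic k)

  combination-power-remainder :
    ∀ {n r f} (monic : Monic r f) {M : Matrix Carrier n n} {a} → IsOrbit M a →
    (∀ i → act f M (a 0) i ≈ 0#) → ∀ k → combination (power-remainder monic k) a ≈ᵛ a k
  combination-power-remainder {r = r} monic {M} {a} orbit fa≈0 zero i = begin
    combination (power-remainder monic 0) a i
      ≈⟨ combination-remainder-step monic orbit fa≈0 1# (λ _ → 0#) i ⟩
    1# * a 0 i + (M *ᵛ combination {r} (λ _ → 0#) a) i
      ≈⟨ +-cong (*-identityˡ _) (*ᵛ-zero M (λ k → dot-zeroˡ {r} (λ _ → ≈-refl) (λ j → a (toℕ j) k)) i) ⟩
    a 0 i + 0#                                 ≈⟨ +-identityʳ _ ⟩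
    a 0 i ∎
  combination-power-remainder monic {M} {a} orbit fa≈0 (suc k) i = begin
    combination (power-remainder monic (suc k)) a i
      ≈⟨ combination-remainder-step monic orbit fa≈0 0# (power-remainder monic k) i ⟩
    0# * a 0 i + (M *ᵛ combination (power-remainder monic k) a) i
      ≈⟨ +-cong (zeroˡ _) (*ᵛ-congʳ M (combination-power-remainder monic orbit fa≈0 k) i) ⟩
    0# + (M *ᵛ a k) i          ≈⟨ +-identityˡ _ ⟩
    (M *ᵛ a k) i               ≈⟨ orbit k i ⟨
    a (suc k) i                ∎

  krylovMatrix : ∀ {n r} → (ℕ → Vector Carrier n) → Matrix Carrier n r
  krylovMatrix a i j = a (toℕ j) i

  -- When `S j` is the remainder of the j-th power of x, Sᵀv is the remainder of the polynomial with
  -- coefficients v, and the value depends only on that remainder.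
  combination-compose :
    ∀ {m n r} (S : Fin n → Vector Carrier r) (a : ℕ → Vector Carrier m) →
    (∀ j → combination (S j) a ≈ᵛ a (toℕ j)) →
    ∀ v i → (krylovMatrix a *ᵛ v) i ≈ combination ((S ᵀ) *ᵛ v) a i
  combination-compose {m} {n} {r} S a Sa≈a v i = begin
    dot (λ j → a (toℕ j) i) v              ≈⟨ dot-comm _ v ⟩
    dot v (λ j → a (toℕ j) i)
      ≈⟨ dot-cong {u = v} (λ _ → ≈-refl) (λ j → sym (Sa≈a j i)) ⟩
    dot v (S *ᵛ (λ k → a (toℕ k) i))       ≈⟨ dot-adjoint v S (λ k → a (toℕ k) i) ⟩
    combination ((S ᵀ) *ᵛ v) a i           ∎

  orbit-krylov : ∀ {m} {A : Matrix Carrier (suc m) (suc m)} {a} → IsOrbit A a →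
                 ∀ (j : Fin m) i → (A *ᵛ a (toℕ (inject₁ j))) i ≈ a (suc (toℕ j)) i
  orbit-krylov {A = A} {a} orbit j i rewrite toℕ-inject₁ j = sym (orbit (toℕ j) i)

  -- By symmetry of A, pairing A u with `a k` is pairing u with `a (suc k)`; the monic annihilator
  -- of degree n brings this vector, even past the last column, back into the column space. This is
  -- what makes y an eigenvector of A in corank 1.
  cokernel-invariant :
    ∀ {n f} {A : Matrix Carrier n n} {a} → A ≈ᴹ A ᵀ → IsOrbit A a → Monic n f → (∀ i → act f A (a 0) i ≈ 0#) →
    ∀ u → (∀ j → ((krylovMatrix {r = n} a ᵀ) *ᵛ u) j ≈ 0#) → ∀ j → ((krylovMatrix {r = n} a ᵀ) *ᵛ (A *ᵛ u)) j ≈ 0#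
  cokernel-invariant {n} {f} {A} {a} A≈Aᵀ orbit monic fa≈0 u Wᵀu≈0 j = begin
    dot (a k) (A *ᵛ u)            ≈⟨ dot-adjoint (a k) A u ⟩
    dot ((A ᵀ) *ᵛ a k) u
      ≈⟨ dot-cong {v = u} (λ i → trans (*ᵛ-cong (λ i j → A≈Aᵀ j i) (λ _ → ≈-refl) i) (sym (orbit k i))) (λ _ → ≈-refl) ⟩
    dot (a (suc k)) u
      ≈⟨ dot-cong {v = u} (λ i → sym (combination-power-remainder monic orbit fa≈0 (suc k) i)) (λ _ → ≈-refl) ⟩
    dot (combination s a) u       ≈⟨ dot-comm _ u ⟩
    dot u (combination s a)       ≈⟨ dot-cong {u = u} (λ _ → ≈-refl) (λ i → dot-comm s _) ⟩
    dot u (W *ᵛ s)                ≈⟨ dot-adjoint u W s ⟩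
    dot ((W ᵀ) *ᵛ u) s            ≈⟨ dot-zeroˡ Wᵀu≈0 s ⟩
    0#                            ∎
    where
    k = toℕ j
    s = power-remainder monic (suc k)
    W : Matrix Carrier n n
    W = krylovMatrix a

  -- A monic annihilator of degree equal to the rank generates the whole kernel.
  monic-kernel-transfer :
    (isIntegralDomain : IsIntegralDomain R) →
    ∀ {m n r f} {A B : Matrix Carrier m m} {a b} → IsOrbit A a → IsOrbit B b → Monic r f →
    (∀ i → act f A (a 0) i ≈ 0#) → (∀ i → act f B (b 0) i ≈ 0#) →
    HasRank (krylovMatrix {r = n} a) r →
    ∀ v → (∀ i → (krylovMatrix a *ᵛ v) i ≈ 0#) → ∀ i → (krylovMatrix b *ᵛ v) i ≈ 0#
  monic-kernel-transfer isIntegralDomain {n = n} {r} {f} {a = a} {b} orbA orbB monic fa≈0 fb≈0 rank v Wv≈0 i =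
    trans (combination-compose S b (λ j → combination-power-remainder monic orbB fb≈0 (toℕ j)) v i)
          (dot-zeroˡ Sᵀv≈0 (λ j → b (toℕ j) i))
    where
    open IntegralDomain R isIntegralDomain using (spanning-independent)
    S : Fin n → Vector Carrier r
    S j = power-remainder monic (toℕ j)
    Sa≈a : ∀ j → combination (S j) a ≈ᵛ a (toℕ j)
    Sa≈a j = combination-power-remainder monic orbA fa≈0 (toℕ j)
    -- The first r orbit vectors span a column space of rank r, so they are independent, and W v = 0
    -- forces the remainder of v to vanish.
    Sᵀv≈0 : ∀ k → ((S ᵀ) *ᵛ v) k ≈ 0#
    Sᵀv≈0 = spanning-independent {X = krylovMatrix {r = n} a} rank (λ j → S j , Sa≈a j) ((S ᵀ) *ᵛ v)
      (λ i → trans (sym (combination-compose S a Sa≈a v i)) (Wv≈0 i))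

-- Polynomials in a symmetric matrix over a Boolean ring

module BooleanRing {c ℓ} (R : CommutativeRing c ℓ)
  (idem : ∀ x → CommutativeRing._≈_ R (CommutativeRing._*_ R x x) x) where
  open CommutativeRing R hiding (zero; refl; ring)
  open CommutativeRing R using () renaming (refl to ≈-refl)
  open MatrixAlgebra R
  open LinearAlgebra R
  open import Relation.Binary.Reasoning.Setoid setoid

  double-zero : ∀ x → x + x ≈ 0#
  double-zero x = begin
    x + x                          ≈⟨ +-identityʳ _ ⟨
    x + x + 0#                     ≈⟨ +-congˡ (-‿inverseʳ (x + x)) ⟨
    x + x + (x + x + - (x + x))    ≈⟨ +-assoc _ _ _ ⟨
    x + x + (x + x) + - (x + x)    ≈⟨ +-congʳ square ⟨
    x + x + - (x + x)              ≈⟨ -‿inverseʳ (x + x) ⟩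
    0#                             ∎
    where
    square : x + x ≈ x + x + (x + x)
    square = begin
      x + x                          ≈⟨ idem (x + x) ⟨
      (x + x) * (x + x)              ≈⟨ distribˡ _ x x ⟩
      (x + x) * x + (x + x) * x      ≈⟨ +-cong expand expand ⟩
      x + x + (x + x)                ∎
      where
      expand : (x + x) * x ≈ x + x
      expand = trans (distribʳ x x x) (+-cong (idem x) (idem x))

  mutual
    OddCoefficientsVanish : List Carrier → Set ℓ
    OddCoefficientsVanish []      = Lift ℓ ⊤
    OddCoefficientsVanish (c ∷ f) = EvenCoefficientsVanish f

    EvenCoefficientsVanish : List Carrier → Set ℓ
    EvenCoefficientsVanish []      = Lift ℓ ⊤
    EvenCoefficientsVanish (c ∷ f) = c ≈ 0# × OddCoefficientsVanish f

  -- If f(x) = g(x²), this is g; over a Boolean ring g(x²) = g(x)², so it is a square root of f.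
  evens : List Carrier → List Carrier
  evens []          = []
  evens (c ∷ [])    = c ∷ []
  evens (c ∷ _ ∷ f) = c ∷ evens f

  act-evens : ∀ {n} f (M : Matrix Carrier n n) u → OddCoefficientsVanish f →
              act f M u ≈ᵛ act (evens f) (M *ᴹ M) u
  act-evens []          M u _ i = ≈-refl
  act-evens (c ∷ [])    M u _ i = +-congˡ (trans (*ᵛ-zero M (λ _ → ≈-refl) i) (sym (*ᵛ-zero (M *ᴹ M) (λ _ → ≈-refl) i)))
  act-evens (c ∷ d ∷ f) M u (d≈0 , f-odd) i = +-congˡ (begin
    (M *ᵛ act (d ∷ f) M u) i
      ≈⟨ *ᵛ-congʳ M (λ k → trans (+-congʳ (trans (*-congʳ d≈0) (zeroˡ _))) (+-identityˡ _)) i ⟩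
    (M *ᵛ (M *ᵛ act f M u)) i     ≈⟨ *ᴹ-*ᵛ M M (act f M u) i ⟨
    ((M *ᴹ M) *ᵛ act f M u) i     ≈⟨ *ᵛ-congʳ (M *ᴹ M) (act-evens f M u f-odd) i ⟩
    ((M *ᴹ M) *ᵛ act (evens f) (M *ᴹ M) u) i ∎)

  -- The Frobenius identity f(M)² = f(M²): coefficients are idempotent, and each cross term occurs
  -- twice and cancels.
  act-square : ∀ {n} f (M : Matrix Carrier n n) u → act f M (act f M u) ≈ᵛ act f (M *ᴹ M) u
  act-square []      M u i = ≈-refl
  act-square (c ∷ f) M u i = begin
    c * v i + (M *ᵛ act f M v) i
      ≈⟨ +-cong (distribˡ c _ _) (*ᵛ-congʳ M actv i) ⟩
    c * (c * u i) + c * (M *ᵛ x) i + (M *ᵛ lincomb c x 1# (act f M (M *ᵛ x))) i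
      ≈⟨ +-cong (+-congʳ (trans (sym (*-assoc c c _)) (*-congʳ (idem c)))) (*ᵛ-linear M c x 1# _ i) ⟩
    c * u i + c * (M *ᵛ x) i + (c * (M *ᵛ x) i + 1# * (M *ᵛ act f M (M *ᵛ x)) i)
      ≈⟨ +-assoc _ _ _ ⟩
    c * u i + (c * (M *ᵛ x) i + (c * (M *ᵛ x) i + 1# * (M *ᵛ act f M (M *ᵛ x)) i))
      ≈⟨ +-congˡ (trans (sym (+-assoc _ _ _)) (trans (+-cong (double-zero _) (*-identityˡ _)) (+-identityˡ _))) ⟩
    c * u i + (M *ᵛ act f M (M *ᵛ x)) i
      ≈⟨ +-congˡ (*ᵛ-congʳ M (act-comm f M x) i) ⟨
    c * u i + (M *ᵛ (M *ᵛ act f M x)) i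
      ≈⟨ +-congˡ (*ᴹ-*ᵛ M M _ i) ⟨
    c * u i + ((M *ᴹ M) *ᵛ act f M x) i
      ≈⟨ +-congˡ (*ᵛ-congʳ (M *ᴹ M) (act-square f M u) i) ⟩
    act (c ∷ f) (M *ᴹ M) u i ∎
    where
    x = act f M u
    v = act (c ∷ f) M u
    actv : act f M v ≈ᵛ lincomb c x 1# (act f M (M *ᵛ x))
    actv k = trans (act-congʳ f M (λ k → +-congˡ (sym (*-identityˡ _))) k) (act-linear f M c u 1# (M *ᵛ x) k)

  -- Since squaring is the identity, (f(M)e)ᵢ is the i-th diagonal entry of f(M)².
  square-zero-ones : ∀ {n} f {M : Matrix Carrier n n} → M ≈ᴹ M ᵀ →
                     (∀ u i → act f M (act f M u) i ≈ 0#) → ∀ i → act f M ones i ≈ 0#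
  square-zero-ones f {M} M≈Mᵀ f²≈0 i = begin
    act f M ones i            ≈⟨ Id-*ᵛ (act f M ones) i ⟨
    dot (Id i) (act f M ones) ≈⟨ act-adjoint f M≈Mᵀ (Id i) ones ⟩
    dot x ones                ≈⟨ sum-cong-≋ (λ j → trans (*-identityʳ (x j)) (sym (idem (x j)))) ⟩
    dot x x                   ≈⟨ act-adjoint f M≈Mᵀ (Id i) x ⟨
    dot (Id i) (act f M x)    ≈⟨ dot-zeroʳ (Id i) (f²≈0 (Id i)) ⟩
    0#                        ∎
    where
    open import Algebra.Properties.Semiring.Sum semiring using (sum-cong-≋)
    x = act f M (Id i)

  evens-annihilates-ones : ∀ {n} f {M : Matrix Carrier n n} → M ≈ᴹ M ᵀ → OddCoefficientsVanish f →
                           (∀ u i → act f M u i ≈ 0#) → ∀ i → act (evens f) M ones i ≈ 0#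
  evens-annihilates-ones f {M} M≈Mᵀ f-odd f≈0 = square-zero-ones (evens f) M≈Mᵀ λ u i →
    trans (act-square (evens f) M u i) (trans (sym (act-evens f M u f-odd i)) (f≈0 u i))

  -- xᵀMx counts every off-diagonal entry twice.
  alternating : ∀ {n} {M : Matrix Carrier n n} → M ≈ᴹ M ᵀ → (∀ i → M i i ≈ 0#) →
                ∀ u → dot u (M *ᵛ u) ≈ 0#
  alternating {zero}  M≈Mᵀ Mᵢᵢ≈0 u = ≈-refl
  alternating {suc n} {M} M≈Mᵀ Mᵢᵢ≈0 u = begin
    u zero * (M zero zero * u zero + r) + dot u⁺ (λ i → M (suc i) zero * u zero + (M⁺ *ᵛ u⁺) i)
      ≈⟨ +-cong (*-congˡ (trans (+-congʳ (trans (*-congʳ (Mᵢᵢ≈0 zero)) (zeroˡ _))) (+-identityˡ r)))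
                (dot-cong {u = u⁺} (λ _ → ≈-refl) (λ i → +-cong (trans (*-comm _ _) (*-congˡ (M≈Mᵀ (suc i) zero))) (sym (*-identityˡ _)))) ⟩
    u zero * r + dot u⁺ (lincomb (u zero) (λ i → M zero (suc i)) 1# (M⁺ *ᵛ u⁺))
      ≈⟨ +-congˡ (dot-linear u⁺ (u zero) _ 1# (M⁺ *ᵛ u⁺)) ⟩
    u zero * r + (u zero * dot u⁺ (λ i → M zero (suc i)) + 1# * dot u⁺ (M⁺ *ᵛ u⁺))
      ≈⟨ +-congˡ (+-cong (*-congˡ (dot-comm u⁺ (λ i → M zero (suc i))))
                         (trans (*-identityˡ _) (alternating (λ i j → M≈Mᵀ (suc i) (suc j)) (λ i → Mᵢᵢ≈0 (suc i)) u⁺))) ⟩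
    u zero * r + (u zero * r + 0#)    ≈⟨ +-congˡ (+-identityʳ _) ⟩
    u zero * r + u zero * r           ≈⟨ double-zero _ ⟩
    0#                                ∎
    where
    u⁺ : Vector Carrier n
    u⁺ i = u (suc i)
    M⁺ : Matrix Carrier n n
    M⁺ i j = M (suc i) (suc j)
    r = dot (λ j → M zero (suc j)) u⁺

  module _ {n} {M : Matrix Carrier n n} (M≈Mᵀ : M ≈ᴹ M ᵀ) (Mᵢᵢ≈0 : ∀ i → M i i ≈ 0#) where
    mutual
      -- Odd powers of an alternating matrix are alternating: moving one factor M to the left
      -- argument turns an odd power at u into the odd power two lower at M u, down to the quadratic
      -- form of M itself.
      dot-act-zero : ∀ f u → EvenCoefficientsVanish f → dot u (act f M u) ≈ 0#
      dot-act-zero []      u _ = dot-zeroʳ u (λ _ → ≈-refl)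
      dot-act-zero (c ∷ f) u (c≈0 , f-odd) = trans
        (dot-cong {u = u} (λ _ → ≈-refl) (λ i → trans (+-congʳ (trans (*-congʳ c≈0) (zeroˡ _))) (+-identityˡ _)))
        (dot-*ᵛ-act-zero f u f-odd)

      dot-*ᵛ-act-zero : ∀ f u → OddCoefficientsVanish f → dot u (M *ᵛ act f M u) ≈ 0#
      dot-*ᵛ-act-zero []      u _ = dot-zeroʳ u (*ᵛ-zero M (λ _ → ≈-refl))
      dot-*ᵛ-act-zero (c ∷ f) u f-even = begin
        dot u (M *ᵛ act (c ∷ f) M u)
          ≈⟨ dot-cong {u = u} (λ _ → ≈-refl) (*ᵛ-congʳ M (λ i → +-congˡ (sym (*-identityˡ _)))) ⟩
        dot u (M *ᵛ lincomb c u 1# (M *ᵛ act f M u))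
          ≈⟨ dot-cong {u = u} (λ _ → ≈-refl) (*ᵛ-linear M c u 1# _) ⟩
        dot u (lincomb c (M *ᵛ u) 1# (M *ᵛ (M *ᵛ act f M u)))
          ≈⟨ dot-linear u c (M *ᵛ u) 1# _ ⟩
        c * dot u (M *ᵛ u) + 1# * dot u (M *ᵛ (M *ᵛ act f M u))
          ≈⟨ +-cong (trans (*-congˡ (alternating M≈Mᵀ Mᵢᵢ≈0 u)) (zeroʳ c)) (*-identityˡ _) ⟩
        0# + dot u (M *ᵛ (M *ᵛ act f M u))
          ≈⟨ +-identityˡ _ ⟩
        dot u (M *ᵛ (M *ᵛ act f M u))
          ≈⟨ dot-adjoint u M _ ⟩
        dot ((M ᵀ) *ᵛ u) (M *ᵛ act f M u)
          ≈⟨ dot-cong (*ᵛ-cong (λ i j → sym (M≈Mᵀ i j)) (λ _ → ≈-refl)) (act-comm f M u) ⟩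
        dot (M *ᵛ u) (act f M (M *ᵛ u))
          ≈⟨ dot-act-zero f (M *ᵛ u) f-even ⟩
        0# ∎

-- Similarity by a regular orthogonal matrix, and Smith normal forms

-- L is the rational orthogonal matrix Q cleared of its denominator l, and
-- B = QᵀAQ.
module Similarity {c ℓ} (R : CommutativeRing c ℓ) where
  open CommutativeRing R hiding (zero; refl; ring)
  open CommutativeRing R using () renaming (refl to ≈-refl)
  open MatrixAlgebra R
  open LinearAlgebra R
  open Orbits R
  open import Relation.Binary.Reasoning.Setoid setoid

  record IsSimilarity {n} (A B L : Matrix Carrier n n) (l : Carrier) : Set (c ⊔ ℓ) where
    field
      A-symmetric : A ≈ᴹ A ᵀ
      intertwines : ∀ v → L *ᵛ (B *ᵛ v) ≈ᵛ A *ᵛ (L *ᵛ v)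
      isometry    : ∀ v i → ((L ᵀ) *ᵛ (L *ᵛ v)) i ≈ l * (l * v i)
      l-cancel    : ∀ x y → l * x ≈ l * y → x ≈ y

    l²-cancel : ∀ x y → l * (l * x) ≈ l * (l * y) → x ≈ y
    l²-cancel x y eq = l-cancel x y (l-cancel _ _ eq)

    isometry-dot : ∀ u v → l * (l * dot u v) ≈ dot (L *ᵛ u) (L *ᵛ v)
    isometry-dot u v = begin
      l * (l * dot u v)                ≈⟨ *-congˡ (dot-scale u l v) ⟨
      l * dot u (λ i → l * v i)        ≈⟨ dot-scale u l _ ⟨
      dot u (λ i → l * (l * v i))      ≈⟨ dot-cong {u = u} (λ _ → ≈-refl) (isometry v) ⟨
      dot u ((L ᵀ) *ᵛ (L *ᵛ v))        ≈⟨ dot-adjoint u (L ᵀ) (L *ᵛ v) ⟩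
      dot (L *ᵛ u) (L *ᵛ v)            ∎

    A-adjoint : ∀ u v → dot u (A *ᵛ v) ≈ dot (A *ᵛ u) v
    A-adjoint u v = trans (dot-adjoint u A v)
      (dot-cong {v = v} (*ᵛ-cong (λ i j → sym (A-symmetric i j)) (λ _ → ≈-refl)) (λ _ → ≈-refl))

    -- B is known here only through LB = AL, so its self-adjointness is read off after applying L to
    -- both arguments and cancelling l twice.
    B-adjoint : ∀ u v → dot u (B *ᵛ v) ≈ dot (B *ᵛ u) v
    B-adjoint u v = l²-cancel _ _ (begin
      l * (l * dot u (B *ᵛ v))         ≈⟨ isometry-dot u (B *ᵛ v) ⟩
      dot (L *ᵛ u) (L *ᵛ (B *ᵛ v))     ≈⟨ dot-cong {u = L *ᵛ u} (λ _ → ≈-refl) (intertwines v) ⟩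
      dot (L *ᵛ u) (A *ᵛ (L *ᵛ v))     ≈⟨ A-adjoint (L *ᵛ u) (L *ᵛ v) ⟩
      dot (A *ᵛ (L *ᵛ u)) (L *ᵛ v)     ≈⟨ dot-cong {v = L *ᵛ v} (intertwines u) (λ _ → ≈-refl) ⟨
      dot (L *ᵛ (B *ᵛ u)) (L *ᵛ v)     ≈⟨ isometry-dot (B *ᵛ u) v ⟨
      l * (l * dot (B *ᵛ u) v)         ∎)

    B-symmetric : B ≈ᴹ B ᵀ
    B-symmetric i j = begin
      B i j                    ≈⟨ *ᵛ-Id B j i ⟨
      (B *ᵛ Id j) i            ≈⟨ Id-*ᵛ (B *ᵛ Id j) i ⟨
      dot (Id i) (B *ᵛ Id j)   ≈⟨ B-adjoint (Id i) (Id j) ⟩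
      dot (B *ᵛ Id i) (Id j)   ≈⟨ dot-comm _ (Id j) ⟩
      dot (Id j) (B *ᵛ Id i)   ≈⟨ Id-*ᵛ (B *ᵛ Id i) j ⟩
      (B *ᵛ Id i) j            ≈⟨ *ᵛ-Id B i j ⟩
      B j i                    ∎

    transpose-intertwines : ∀ x → (L ᵀ) *ᵛ (A *ᵛ x) ≈ᵛ B *ᵛ ((L ᵀ) *ᵛ x)
    transpose-intertwines x i = begin
      ((L ᵀ) *ᵛ (A *ᵛ x)) i          ≈⟨ Id-*ᵛ ((L ᵀ) *ᵛ (A *ᵛ x)) i ⟨
      dot (Id i) ((L ᵀ) *ᵛ (A *ᵛ x)) ≈⟨ dot-adjoint (Id i) (L ᵀ) (A *ᵛ x) ⟩
      dot (L *ᵛ Id i) (A *ᵛ x)       ≈⟨ A-adjoint (L *ᵛ Id i) x ⟩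
      dot (A *ᵛ (L *ᵛ Id i)) x       ≈⟨ dot-cong {v = x} (intertwines (Id i)) (λ _ → ≈-refl) ⟨
      dot (L *ᵛ (B *ᵛ Id i)) x       ≈⟨ dot-adjoint (B *ᵛ Id i) (L ᵀ) x ⟨
      dot (B *ᵛ Id i) ((L ᵀ) *ᵛ x)   ≈⟨ B-adjoint (Id i) ((L ᵀ) *ᵛ x) ⟨
      dot (Id i) (B *ᵛ ((L ᵀ) *ᵛ x)) ≈⟨ Id-*ᵛ (B *ᵛ ((L ᵀ) *ᵛ x)) i ⟩
      (B *ᵛ ((L ᵀ) *ᵛ x)) i          ∎

    -- L f(B) u = f(A) L u = 0, and LᵀL is the scalar l², which can be cancelled over ℤ but possibly
    -- not modulo p.
    annihilates-transfer : ∀ f → (∀ u i → act f A u i ≈ 0#) → ∀ u i → act f B u i ≈ 0#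
    annihilates-transfer f fA≈0 u i = l²-cancel _ _ (begin
      l * (l * act f B u i)              ≈⟨ isometry (act f B u) i ⟨
      ((L ᵀ) *ᵛ (L *ᵛ act f B u)) i
        ≈⟨ *ᵛ-zero (L ᵀ) (λ k → trans (act-intertwine f B A L intertwines u k) (fA≈0 (L *ᵛ u) k)) i ⟩
      0#                                 ≈⟨ trans (*-congˡ (zeroʳ l)) (zeroʳ l) ⟨
      l * (l * 0#)                       ∎)

    module _ {a b : ℕ → Vector Carrier n} (orbA : IsOrbit A a) (orbB : IsOrbit B b)
             (L-start : ∀ i → (L *ᵛ b 0) i ≈ l * a 0 i) {r : ℕ} where
      private
        W W′ : Matrix Carrier n r
        W  = krylovMatrix a
        W′ = krylovMatrix b

      L-orbit : ∀ k i → (L *ᵛ b k) i ≈ l * a k i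
      L-orbit zero    i = L-start i
      L-orbit (suc k) i = begin
        (L *ᵛ b (suc k)) i           ≈⟨ *ᵛ-congʳ L (orbB k) i ⟩
        (L *ᵛ (B *ᵛ b k)) i          ≈⟨ intertwines (b k) i ⟩
        (A *ᵛ (L *ᵛ b k)) i          ≈⟨ *ᵛ-congʳ A (L-orbit k) i ⟩
        (A *ᵛ (λ j → l * a k j)) i   ≈⟨ *ᵛ-scale A l (a k) i ⟩
        l * (A *ᵛ a k) i             ≈⟨ *-congˡ (orbA k i) ⟨
        l * a (suc k) i              ∎

      L-krylov : ∀ v i → (L *ᵛ (W′ *ᵛ v)) i ≈ l * (W *ᵛ v) i
      L-krylov v i = begin
        (L *ᵛ (W′ *ᵛ v)) i            ≈⟨ *ᴹ-*ᵛ L W′ v i ⟨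
        dot ((L *ᴹ W′) i) v           ≈⟨ dot-comm _ v ⟩
        dot v ((L *ᴹ W′) i)           ≈⟨ dot-cong {u = v} (λ _ → ≈-refl) (λ j → L-orbit (toℕ j) i) ⟩
        dot v (λ j → l * W i j)       ≈⟨ dot-scale v l (W i) ⟩
        l * dot v (W i)               ≈⟨ *-congˡ (dot-comm v (W i)) ⟩
        l * (W *ᵛ v) i                ∎

      -- QW′ = W and QᵀQ = 1. Stated without L, the identity keeps its content modulo a prime that
      -- divides l.
      gram : ∀ u v → dot (W *ᵛ u) (W *ᵛ v) ≈ dot (W′ *ᵛ u) (W′ *ᵛ v)
      gram u v = l²-cancel _ _ (begin
        l * (l * dot (W *ᵛ u) (W *ᵛ v))
          ≈⟨ *-congˡ (dot-scale (W *ᵛ u) l (W *ᵛ v)) ⟨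
        l * dot (W *ᵛ u) (λ i → l * (W *ᵛ v) i)
          ≈⟨ *-congˡ (dot-comm (W *ᵛ u) _) ⟩
        l * dot (λ i → l * (W *ᵛ v) i) (W *ᵛ u)
          ≈⟨ dot-scale _ l (W *ᵛ u) ⟨
        dot (λ i → l * (W *ᵛ v) i) (λ i → l * (W *ᵛ u) i)
          ≈⟨ dot-cong (L-krylov v) (L-krylov u) ⟨
        dot (L *ᵛ (W′ *ᵛ v)) (L *ᵛ (W′ *ᵛ u))
          ≈⟨ dot-comm (L *ᵛ (W′ *ᵛ v)) _ ⟩
        dot (L *ᵛ (W′ *ᵛ u)) (L *ᵛ (W′ *ᵛ v))
          ≈⟨ isometry-dot (W′ *ᵛ u) (W′ *ᵛ v) ⟨
        l * (l * dot (W′ *ᵛ u) (W′ *ᵛ v)) ∎)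

      module _ (Y : Matrix Carrier r n) (d : Carrier) (WY≈d : ∀ x i → (W *ᵛ (Y *ᵛ x)) i ≈ d * x i) where

        -- This is W′Y = d Qᵀ multiplied by l: apply Lᵀ to L W′ Y = l W Y = l d, use that LᵀL is l²,
        -- and cancel one factor l.
        scaled-transpose : ∀ x i → l * (W′ *ᵛ (Y *ᵛ x)) i ≈ d * ((L ᵀ) *ᵛ x) i
        scaled-transpose x i = l-cancel _ _ (begin
          l * (l * (W′ *ᵛ (Y *ᵛ x)) i)              ≈⟨ isometry (W′ *ᵛ (Y *ᵛ x)) i ⟨
          ((L ᵀ) *ᵛ (L *ᵛ (W′ *ᵛ (Y *ᵛ x)))) i
            ≈⟨ *ᵛ-congʳ (L ᵀ) (λ k → trans (L-krylov (Y *ᵛ x) k) (*-congˡ (WY≈d x k))) i ⟩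
          ((L ᵀ) *ᵛ (λ k → l * (d * x k))) i        ≈⟨ *ᵛ-scale (L ᵀ) l _ i ⟩
          l * ((L ᵀ) *ᵛ (λ k → d * x k)) i          ≈⟨ *-congˡ (*ᵛ-scale (L ᵀ) d x i) ⟩
          l * (d * ((L ᵀ) *ᵛ x) i)                  ∎)

        -- The relation QᵀA = BQᵀ multiplied by d. Through W′Y = d Qᵀ it is expressed without L or
        -- l, ready for reduction modulo p.
        scaled-intertwines : ∀ x i → (W′ *ᵛ (Y *ᵛ (A *ᵛ x))) i ≈ (B *ᵛ (W′ *ᵛ (Y *ᵛ x))) i
        scaled-intertwines x i = l-cancel _ _ (begin
          l * (W′ *ᵛ (Y *ᵛ (A *ᵛ x))) i             ≈⟨ scaled-transpose (A *ᵛ x) i ⟩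
          d * ((L ᵀ) *ᵛ (A *ᵛ x)) i                 ≈⟨ *-congˡ (transpose-intertwines x i) ⟩
          d * (B *ᵛ ((L ᵀ) *ᵛ x)) i                 ≈⟨ *ᵛ-scale B d _ i ⟨
          (B *ᵛ (λ k → d * ((L ᵀ) *ᵛ x) k)) i       ≈⟨ *ᵛ-congʳ B (scaled-transpose x) i ⟨
          (B *ᵛ (λ k → l * (W′ *ᵛ (Y *ᵛ x)) k)) i   ≈⟨ *ᵛ-scale B l _ i ⟩
          l * (B *ᵛ (W′ *ᵛ (Y *ᵛ x))) i             ∎)

-- Y is d W⁻¹ without the division, so that W′Y = d Qᵀ for W′ = QᵀW.
record Smith {c ℓ} (R : CommutativeRing c ℓ) {m} (W : Matrix (CommutativeRing.Carrier R) (suc m) (suc m)) : Set (c ⊔ ℓ) where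
  open CommutativeRing R hiding (zero; refl; ring)
  open CommutativeRing R using () renaming (refl to ≈-refl)
  open MatrixAlgebra R
  open LinearAlgebra R
  field
    U U⁻¹ V V⁻¹ : Matrix Carrier (suc m) (suc m)
    D D*        : Vector Carrier (suc m)
    UU⁻¹ : U *ᴹ U⁻¹ ≈ᴹ Id
    U⁻¹U : U⁻¹ *ᴹ U ≈ᴹ Id
    VV⁻¹ : V *ᴹ V⁻¹ ≈ᴹ Id
    UWV  : U *ᴹ W *ᴹ V ≈ᴹ diag D
    DD*  : ∀ k → D k * D* k ≈ D (fromℕ m)

  open import Relation.Binary.Reasoning.Setoid setoid

  d : Carrier
  d = D (fromℕ m)

  Z Y : Matrix Carrier (suc m) (suc m)
  Z k j = D* k * U k j
  Y = V *ᴹ Z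

  UWV-*ᵛ : ∀ x i → (U *ᵛ (W *ᵛ (V *ᵛ x))) i ≈ D i * x i
  UWV-*ᵛ x i = begin
    (U *ᵛ (W *ᵛ (V *ᵛ x))) i     ≈⟨ *ᴹ-*ᵛ U W (V *ᵛ x) i ⟨
    ((U *ᴹ W) *ᵛ (V *ᵛ x)) i     ≈⟨ *ᴹ-*ᵛ (U *ᴹ W) V x i ⟨
    ((U *ᴹ W *ᴹ V) *ᵛ x) i       ≈⟨ *ᵛ-cong {u = x} UWV (λ _ → ≈-refl) i ⟩
    (diag D *ᵛ x) i              ≈⟨ diag-dot D x i ⟩
    D i * x i                    ∎

  WV-*ᵛ : ∀ x → W *ᵛ (V *ᵛ x) ≈ᵛ U⁻¹ *ᵛ (λ k → D k * x k)
  WV-*ᵛ x i = begin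
    (W *ᵛ (V *ᵛ x)) i                    ≈⟨ inverse-*ᵛ {X = U⁻¹} {U} U⁻¹U (W *ᵛ (V *ᵛ x)) i ⟨
    (U⁻¹ *ᵛ (U *ᵛ (W *ᵛ (V *ᵛ x)))) i    ≈⟨ *ᵛ-congʳ U⁻¹ (UWV-*ᵛ x) i ⟩
    (U⁻¹ *ᵛ (λ k → D k * x k)) i         ∎

  W-*ᵛ : ∀ x → W *ᵛ x ≈ᵛ U⁻¹ *ᵛ (λ k → D k * (V⁻¹ *ᵛ x) k)
  W-*ᵛ x i = trans (*ᵛ-congʳ W (λ k → sym (inverse-*ᵛ {X = V} {V⁻¹} VV⁻¹ x k)) i) (WV-*ᵛ (V⁻¹ *ᵛ x) i)

  UW-*ᵛ : ∀ x i → (U *ᵛ (W *ᵛ x)) i ≈ D i * (V⁻¹ *ᵛ x) i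
  UW-*ᵛ x i = trans (*ᵛ-congʳ U (*ᵛ-congʳ W (λ k → sym (inverse-*ᵛ {X = V} {V⁻¹} VV⁻¹ x k))) i) (UWV-*ᵛ (V⁻¹ *ᵛ x) i)

  WY : ∀ x i → (W *ᵛ (Y *ᵛ x)) i ≈ d * x i
  WY x i = begin
    (W *ᵛ (Y *ᵛ x)) i                           ≈⟨ *ᵛ-congʳ W (*ᴹ-*ᵛ V Z x) i ⟩
    (W *ᵛ (V *ᵛ (Z *ᵛ x))) i                    ≈⟨ WV-*ᵛ (Z *ᵛ x) i ⟩
    (U⁻¹ *ᵛ (λ k → D k * (Z *ᵛ x) k)) i         ≈⟨ *ᵛ-congʳ U⁻¹ cofactor i ⟩
    (U⁻¹ *ᵛ (λ k → d * (U *ᵛ x) k)) i           ≈⟨ *ᵛ-scale U⁻¹ d (U *ᵛ x) i ⟩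
    d * (U⁻¹ *ᵛ (U *ᵛ x)) i                     ≈⟨ *-congˡ (inverse-*ᵛ {X = U⁻¹} {U} U⁻¹U x i) ⟩
    d * x i                                     ∎
    where
    cofactor : ∀ k → D k * (Z *ᵛ x) k ≈ d * (U *ᵛ x) k
    cofactor k = begin
      D k * dot (λ j → D* k * U k j) x    ≈⟨ *-congˡ (dot-comm (Z k) x) ⟩
      D k * dot x (λ j → D* k * U k j)    ≈⟨ *-congˡ (dot-scale x (D* k) (U k)) ⟩
      D k * (D* k * dot x (U k))          ≈⟨ *-assoc _ _ _ ⟨
      D k * D* k * dot x (U k)            ≈⟨ *-cong (DD* k) (dot-comm x (U k)) ⟩
      d * (U *ᵛ x) k                      ∎

  module _ (isIntegralDomain : IsIntegralDomain R) where
    open IsIntegralDomain isIntegralDomain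
    open IntegralDomain R isIntegralDomain

    D-Id : ∀ k j → D j * Id k j ≈ D k * Id k j
    D-Id k j with j ≟ k
    ... | yes refl = ≈-refl
    ... | no  j≢k  = trans (trans (*-congˡ off) (zeroʳ _)) (sym (trans (*-congˡ off) (zeroʳ _)))
      where off = Id-≢ λ k≡j → j≢k (≡.sym k≡j)

    V-column-kernel : ∀ k → D k ≈ 0# → Zero (W *ᵛ (V *ᵛ Id k))
    V-column-kernel k Dₖ≈0 i = trans (WV-*ᵛ (Id k) i)
      (*ᵛ-zero U⁻¹ (λ j → trans (D-Id k j) (trans (*-congʳ Dₖ≈0) (zeroˡ _))) i)

    kernel-coordinates : ∀ g → Zero (W *ᵛ g) → ∀ k → D k * (V⁻¹ *ᵛ g) k ≈ 0#
    kernel-coordinates g Wg≈0 k = trans (sym (UW-*ᵛ g k)) (*ᵛ-zero U Wg≈0 k)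

    -- Column k of WV is D k times column k of U⁻¹, and u is orthogonal to the column space of W.
    cokernel-coordinates : ∀ u → Zero ((W ᵀ) *ᵛ u) → ∀ k → D k * ((U⁻¹ ᵀ) *ᵛ u) k ≈ 0#
    cokernel-coordinates u Wᵀu≈0 k = begin
      D k * z k
        ≈⟨ *-congˡ (trans (sym (Id-*ᵛ z k)) (dot-comm (Id k) z)) ⟩
      D k * dot z (Id k)                     ≈⟨ dot-scale z (D k) (Id k) ⟨
      dot z (λ j → D k * Id k j)             ≈⟨ dot-cong {u = z} (λ _ → ≈-refl) (D-Id k) ⟨
      dot z (λ j → D j * Id k j)             ≈⟨ dot-adjoint u U⁻¹ (λ j → D j * Id k j) ⟨
      dot u (U⁻¹ *ᵛ (λ j → D j * Id k j))    ≈⟨ dot-cong {u = u} (λ _ → ≈-refl) (WV-*ᵛ (Id k)) ⟨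
      dot u (W *ᵛ (V *ᵛ Id k))               ≈⟨ dot-adjoint u W (V *ᵛ Id k) ⟩
      dot ((W ᵀ) *ᵛ u) (V *ᵛ Id k)           ≈⟨ dot-zeroˡ Wᵀu≈0 (V *ᵛ Id k) ⟩
      0#                                     ∎
      where z = (U⁻¹ ᵀ) *ᵛ u

    D*-zero : d ≈ 0# → ∀ k → ¬ (D k ≈ 0#) → D* k ≈ 0#
    D*-zero d≈0 k Dₖ≉0 = cancel-nonzero Dₖ≉0 (trans (DD* k) d≈0)

    -- Every D k divides d, so for nonzero d none of them would vanish and W would be injective.
    deficient⇒d≈0 : ∀ {r} → HasRank W r → r ℕ.< suc m → d ≈ 0#
    deficient⇒d≈0 rank r≤m with rank-deficient-kernel {X = W} rank r≤m
    ... | a , (i , aᵢ≉0) , Wa≈0 = decidable-stable (zero? d) λ d≉0 →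
      aᵢ≉0 (trans (sym (inverse-*ᵛ {X = V} {V⁻¹} VV⁻¹ a i)) (*ᵛ-zero V {V⁻¹ *ᵛ a} (λ k →
        cancel-nonzero (λ Dₖ≈0 → d≉0 (trans (sym (DD* k)) (trans (*-congʳ Dₖ≈0) (zeroˡ _))))
                       (kernel-coordinates a Wa≈0 k)) i))

    -- Since d vanishes, the first m columns of U⁻¹, each scaled by its D k, already span the column
    -- space of W. They are as many as the rank, hence independent, and none of them is zero.
    corank-1⇒D≉0 : HasRank W m → ∀ k → ¬ (D (inject₁ k) ≈ 0#)
    corank-1⇒D≉0 rank k Dₖ≈0 = 1≉0 (trans (sym (Id-≡ k)) (independent (Id k) combination≈0 k))
      where
      d≈0 = deficient⇒d≈0 rank (ℕ.n<1+n m)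
      basis : Fin m → Vector Carrier (suc m)
      basis k i = U⁻¹ i (inject₁ k) * D (inject₁ k)
      spans : ∀ j → InSpan basis ((W ᵀ) j)
      spans j = (λ k → V⁻¹ (inject₁ k) j) , λ i → sym (begin
        W i j                                              ≈⟨ *ᵛ-Id W j i ⟨
        (W *ᵛ Id j) i                                      ≈⟨ W-*ᵛ (Id j) i ⟩
        (U⁻¹ *ᵛ (λ k → D k * (V⁻¹ *ᵛ Id j) k)) i
          ≈⟨ sum-init-last {m} (λ k → U⁻¹ i k * (D k * (V⁻¹ *ᵛ Id j) k)) ⟩
        sum (λ k → U⁻¹ i (inject₁ k) * (D (inject₁ k) * (V⁻¹ *ᵛ Id j) (inject₁ k))) + U⁻¹ i (fromℕ m) * (d * (V⁻¹ *ᵛ Id j) (fromℕ m))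
          ≈⟨ +-cong (sum-cong-≋ (λ k → trans (sym (*-assoc _ _ _)) (trans (*-comm _ _) (*-congʳ (*ᵛ-Id V⁻¹ j (inject₁ k))))))
                    (trans (*-congˡ (trans (*-congʳ d≈0) (zeroˡ _))) (zeroʳ _)) ⟩
        sum (λ k → V⁻¹ (inject₁ k) j * basis k i) + 0#      ≈⟨ +-identityʳ _ ⟩
        linearCombination (λ k → V⁻¹ (inject₁ k) j) basis i ∎)
        where open import Algebra.Properties.Semiring.Sum semiring using (sum-cong-≋; sum-init-last)
      independent : LinearlyIndependent basis
      independent = spanning-independent {X = W} rank spans
      combination≈0 : ∀ i → linearCombination (Id k) basis i ≈ 0#
      combination≈0 i = trans (Id-*ᵛ (λ k → basis k i) k) (trans (*-congˡ Dₖ≈0) (zeroʳ _))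

    module _ (W′ : Matrix Carrier (suc m) (suc m)) where

      -- W′Y is the sum over k of column k of W′V times D* k times row k of U, so one zero factor in
      -- every term suffices.
      vanishes : (∀ k → D* k ≈ 0# ⊎ Zero (W′ *ᵛ (V *ᵛ Id k))) → ∀ x → Zero (W′ *ᵛ (Y *ᵛ x))
      vanishes vanish x i = begin
        (W′ *ᵛ (Y *ᵛ x)) i           ≈⟨ *ᵛ-congʳ W′ (*ᴹ-*ᵛ V Z x) i ⟩
        (W′ *ᵛ (V *ᵛ (Z *ᵛ x))) i    ≈⟨ *ᴹ-*ᵛ W′ V (Z *ᵛ x) i ⟨
        ((W′ *ᴹ V) *ᵛ (Z *ᵛ x)) i    ≈⟨ sum-zero (λ k → term k (vanish k)) ⟩
        0#                           ∎
        where
        term : ∀ k → D* k ≈ 0# ⊎ Zero (W′ *ᵛ (V *ᵛ Id k)) → (W′ *ᴹ V) i k * (Z *ᵛ x) k ≈ 0#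
        term k (inj₁ D*ₖ≈0) = trans (*-congˡ (dot-zeroˡ {u = Z k} (λ j → trans (*-congʳ D*ₖ≈0) (zeroˡ _)) x)) (zeroʳ _)
        term k (inj₂ W′Vₖ≈0) = trans (*-congʳ (trans (sym (*ᵛ-Id (W′ *ᴹ V) k i))
          (trans (*ᴹ-*ᵛ W′ V (Id k) i) (W′Vₖ≈0 i)))) (zeroˡ _)

      -- Where D k is zero, column k of V lies in ker W and so in ker W′; where it is not, D k * D*
      -- k = d = 0 kills D* k.
      transfer⇒vanishes : ∀ {r} → HasRank W r → r ℕ.< suc m →
                          (∀ v → Zero (W *ᵛ v) → Zero (W′ *ᵛ v)) → ∀ x → Zero (W′ *ᵛ (Y *ᵛ x))
      transfer⇒vanishes rank r≤m transfer = vanishes alternative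
        where
        alternative : ∀ k → D* k ≈ 0# ⊎ Zero (W′ *ᵛ (V *ᵛ Id k))
        alternative k with zero? (D k)
        ... | yes Dₖ≈0 = inj₂ (transfer (V *ᵛ Id k) (V-column-kernel k Dₖ≈0))
        ... | no  Dₖ≉0 = inj₁ (D*-zero (deficient⇒d≈0 rank r≤m) k Dₖ≉0)

      module _ {A B : Matrix Carrier (suc m) (suc m)} (rank : HasRank W m) where
        private
          l = fromℕ m
          v = V *ᵛ Id l
          y = U l
          w = W′ *ᵛ v

          d≈0 : d ≈ 0#
          d≈0 = deficient⇒d≈0 rank (ℕ.n<1+n m)

          D*≈0 : ∀ k → D* (inject₁ k) ≈ 0#
          D*≈0 k = D*-zero d≈0 (inject₁ k) (corank-1⇒D≉0 rank k)

          last-only : ∀ (z : Vector Carrier (suc m)) → (∀ k → z (inject₁ k) ≈ 0#) → ∀ i → z i ≈ z l * Id l i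
          last-only z z≈0 i with view i
          ... | ‵fromℕ     = sym (trans (*-congˡ (Id-≡ l)) (*-identityʳ _))
          ... | ‵inject₁ k = trans (z≈0 k) (sym (trans (*-congˡ (Id-≢ {i = l} {inject₁ k} fromℕ≢inject₁)) (zeroʳ _)))

          kerW : ∀ g → Zero (W *ᵛ g) → ∃[ α ] (∀ i → g i ≈ α * v i)
          kerW g Wg≈0 = z l , λ i → begin
            g i                               ≈⟨ inverse-*ᵛ {X = V} {V⁻¹} VV⁻¹ g i ⟨
            (V *ᵛ z) i
              ≈⟨ *ᵛ-congʳ V (last-only z λ k → cancel-nonzero (corank-1⇒D≉0 rank k) (kernel-coordinates g Wg≈0 (inject₁ k))) i ⟩
            (V *ᵛ (λ j → z l * Id l j)) i     ≈⟨ *ᵛ-scale V (z l) (Id l) i ⟩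
            z l * v i                         ∎
            where z = V⁻¹ *ᵛ g

          kerWᵀ : ∀ u → Zero ((W ᵀ) *ᵛ u) → ∃[ κ ] (∀ j → u j ≈ κ * y j)
          kerWᵀ u Wᵀu≈0 = z l , λ j → begin
            u j                                       ≈⟨ Id-*ᵛ u j ⟨
            dot (Id j) u                              ≈⟨ dot-comm (Id j) u ⟩
            dot u (Id j)
              ≈⟨ dot-cong {u = u} (λ _ → ≈-refl) (inverse-*ᵛ {X = U⁻¹} {U} U⁻¹U (Id j)) ⟨
            dot u (U⁻¹ *ᵛ (U *ᵛ Id j))                ≈⟨ dot-adjoint u U⁻¹ (U *ᵛ Id j) ⟩
            dot z (U *ᵛ Id j)
              ≈⟨ dot-cong {v = U *ᵛ Id j} (last-only z λ k → cancel-nonzero (corank-1⇒D≉0 rank k) (cokernel-coordinates u Wᵀu≈0 (inject₁ k))) (λ _ → ≈-refl) ⟩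
            dot (λ i → z l * Id l i) (U *ᵛ Id j)      ≈⟨ dot-comm (λ i → z l * Id l i) (U *ᵛ Id j) ⟩
            dot (U *ᵛ Id j) (λ i → z l * Id l i)      ≈⟨ dot-scale (U *ᵛ Id j) (z l) (Id l) ⟩
            z l * dot (U *ᵛ Id j) (Id l)
              ≈⟨ *-congˡ (trans (dot-comm (U *ᵛ Id j) (Id l)) (Id-*ᵛ (U *ᵛ Id j) l)) ⟩
            z l * (U *ᵛ Id j) l                       ≈⟨ *-congˡ (*ᵛ-Id U j l) ⟩
            z l * y j                                 ∎
            where z = (U⁻¹ ᵀ) *ᵛ u

          y≉0 : Nonzero y
          y≉0 with any? (λ j → ¬? (zero? (y j)))
          ... | yes nonzero = nonzero
          ... | no  all-zero = contradiction (trans (sym (Id-≡ l)) (trans (sym (UU⁻¹ l l))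
                  (dot-zeroˡ (λ j → decidable-stable (zero? (y j)) (λ yⱼ≉0 → all-zero (j , yⱼ≉0))) (λ k → U⁻¹ k l)))) 1≉0

          Wᵀy≈0 : Zero ((W ᵀ) *ᵛ y)
          Wᵀy≈0 j = begin
            ((W ᵀ) *ᵛ y) j        ≈⟨ column W y j ⟩
            dot (W *ᵛ Id j) y     ≈⟨ dot-comm (W *ᵛ Id j) y ⟩
            (U *ᵛ (W *ᵛ Id j)) l  ≈⟨ UW-*ᵛ (Id j) l ⟩
            d * (V⁻¹ *ᵛ Id j) l   ≈⟨ trans (*-congʳ d≈0) (zeroˡ _) ⟩
            0#                    ∎

          -- Only the last D* can be nonzero, so d Qᵀ has become the matrix D* l times w yᵀ, of rank
          -- at most one.
          W′Y : ∀ x i → (W′ *ᵛ (Y *ᵛ x)) i ≈ (D* l * (U *ᵛ x) l) * w i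
          W′Y x i = begin
            (W′ *ᵛ (Y *ᵛ x)) i                           ≈⟨ *ᵛ-congʳ W′ (*ᴹ-*ᵛ V Z x) i ⟩
            (W′ *ᵛ (V *ᵛ (Z *ᵛ x))) i
              ≈⟨ *ᵛ-congʳ W′ (*ᵛ-congʳ V (last-only (Z *ᵛ x) λ k → dot-zeroˡ {u = Z (inject₁ k)} (λ j → trans (*-congʳ (D*≈0 k)) (zeroˡ _)) x)) i ⟩
            (W′ *ᵛ (V *ᵛ (λ j → (Z *ᵛ x) l * Id l j))) i
              ≈⟨ *ᵛ-congʳ W′ (*ᵛ-scale V ((Z *ᵛ x) l) (Id l)) i ⟩
            (W′ *ᵛ (λ j → (Z *ᵛ x) l * v j)) i           ≈⟨ *ᵛ-scale W′ ((Z *ᵛ x) l) v i ⟩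
            (Z *ᵛ x) l * w i
              ≈⟨ *-congʳ (trans (dot-comm (Z l) x) (trans (dot-scale x (D* l) y) (*-congˡ (dot-comm x y)))) ⟩
            (D* l * (U *ᵛ x) l) * w i                    ∎

        -- By the rank one form of W′Y, either D* l is zero or w has to be. In the second case D* l
        -- can be cancelled from the intertwining relation, which gives it the shape that
        -- `kernel-transfer` asks for.
        corank-1⇒vanishes :
          A ≈ᴹ A ᵀ → IsKrylov A W → IsKrylov B W′ →
          (∀ a b → dot (W *ᵛ a) (W *ᵛ b) ≈ dot (W′ *ᵛ a) (W′ *ᵛ b)) →
          (∀ u → Zero ((W ᵀ) *ᵛ u) → Zero ((W ᵀ) *ᵛ (A *ᵛ u))) →
          (∀ x i → (W′ *ᵛ (Y *ᵛ (A *ᵛ x))) i ≈ (B *ᵛ (W′ *ᵛ (Y *ᵛ x))) i) →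
          ∀ x → Zero (W′ *ᵛ (Y *ᵛ x))
        corank-1⇒vanishes A≈Aᵀ krylov krylov′ gram invariant intertwines = vanishes alternative
          where
          eigen : ∃[ μ ] (∀ i → (A *ᵛ y) i ≈ μ * y i)
          eigen = kerWᵀ (A *ᵛ y) (invariant y Wᵀy≈0)

          swapped : ¬ (D* l ≈ 0#) → ∀ i j → w i * (A *ᵛ y) j ≈ (B *ᵛ w) i * y j
          swapped D*ₗ≉0 i j = cancelˡ D*ₗ≉0 (begin
            D* l * (w i * (A *ᵛ y) j)
              ≈⟨ trans (*-congˡ (*-comm _ _)) (sym (*-assoc _ _ _)) ⟩
            (D* l * (A *ᵛ y) j) * w i                  ≈⟨ *-congʳ (*-congˡ Ay) ⟩
            (D* l * (U *ᵛ (A *ᵛ Id j)) l) * w i        ≈⟨ W′Y (A *ᵛ Id j) i ⟨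
            (W′ *ᵛ (Y *ᵛ (A *ᵛ Id j))) i               ≈⟨ intertwines (Id j) i ⟩
            (B *ᵛ (W′ *ᵛ (Y *ᵛ Id j))) i               ≈⟨ *ᵛ-congʳ B (W′Y (Id j)) i ⟩
            (B *ᵛ (λ k → (D* l * (U *ᵛ Id j) l) * w k)) i ≈⟨ *ᵛ-scale B _ w i ⟩
            (D* l * (U *ᵛ Id j) l) * (B *ᵛ w) i        ≈⟨ *-congʳ (*-congˡ (*ᵛ-Id U j l)) ⟩
            (D* l * y j) * (B *ᵛ w) i
              ≈⟨ trans (*-assoc _ _ _) (*-congˡ (*-comm _ _)) ⟩
            D* l * ((B *ᵛ w) i * y j)                  ∎)
            where
            Ay : (A *ᵛ y) j ≈ (U *ᵛ (A *ᵛ Id j)) l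
            Ay = begin
              (A *ᵛ y) j               ≈⟨ *ᵛ-cong {u = y} A≈Aᵀ (λ _ → ≈-refl) j ⟩
              ((A ᵀ) *ᵛ y) j           ≈⟨ column A y j ⟩
              dot (A *ᵛ Id j) y        ≈⟨ dot-comm (A *ᵛ Id j) y ⟩
              (U *ᵛ (A *ᵛ Id j)) l     ∎

          alternative : ∀ k → D* k ≈ 0# ⊎ Zero (W′ *ᵛ (V *ᵛ Id k))
          alternative k with view k
          ... | ‵inject₁ k = inj₁ (D*≈0 k)
          ... | ‵fromℕ with zero? (D* l)
          ...   | yes D*ₗ≈0 = inj₁ D*ₗ≈0
          ...   | no  D*ₗ≉0 = inj₂ (kernel-transfer {A = A} {B} {W} {W′} {v} {y} {proj₁ eigen} krylov krylov′ gram
                    (V-column-kernel l d≈0) kerW y≉0 kerWᵀ (proj₂ eigen) (swapped D*ₗ≉0))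

-- Integer vectors and differences of integer polynomials

open ≡ using (sym; trans; cong; cong₂; subst; module ≡-Reasoning)
open import Data.Integer.Base using (_+_; _*_; _-_; -_)
open ℤᴹ using (_*ᵛ_; _*ᴹ_; Id; ones; adjacency; walkVector; walkMatrix)

module Qᴸ = LinearAlgebra ℚ.+-*-commutativeRing
open LinearAlgebra ℤ.+-*-commutativeRing
open Similarity ℤ.+-*-commutativeRing using (IsSimilarity)
open Orbits ℤ.+-*-commutativeRing using (krylovMatrix)

*ᵛ-+ : ∀ {m n} (X : Matrix ℤ m n) u v i → (X *ᵛ (λ j → u j + v j)) i ≡ (X *ᵛ u) i + (X *ᵛ v) i
*ᵛ-+ X u v i = begin
  (X *ᵛ (λ j → u j + v j)) i
    ≡⟨ *ᵛ-congʳ X (λ j → cong₂ ℤ._+_ (ℤ.*-identityˡ (u j)) (ℤ.*-identityˡ (v j))) i ⟨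
  (X *ᵛ lincomb 1ℤ u 1ℤ v) i
    ≡⟨ *ᵛ-linear X 1ℤ u 1ℤ v i ⟩
  1ℤ * (X *ᵛ u) i + 1ℤ * (X *ᵛ v) i
    ≡⟨ cong₂ ℤ._+_ (ℤ.*-identityˡ ((X *ᵛ u) i)) (ℤ.*-identityˡ ((X *ᵛ v) i)) ⟩
  (X *ᵛ u) i + (X *ᵛ v) i ∎
  where open ≡-Reasoning

*ᵛ-- : ∀ {m n} (X : Matrix ℤ m n) u v i → (X *ᵛ (λ j → u j - v j)) i ≡ (X *ᵛ u) i - (X *ᵛ v) i
*ᵛ-- X u v i = begin
  (X *ᵛ (λ j → u j - v j)) i
    ≡⟨ *ᵛ-congʳ X (λ j → eq (u j) (v j)) i ⟩
  (X *ᵛ lincomb 1ℤ u -1ℤ v) i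
    ≡⟨ *ᵛ-linear X 1ℤ u -1ℤ v i ⟩
  1ℤ * (X *ᵛ u) i + -1ℤ * (X *ᵛ v) i
    ≡⟨ eq ((X *ᵛ u) i) ((X *ᵛ v) i) ⟨
  (X *ᵛ u) i - (X *ᵛ v) i ∎
  where
  open ≡-Reasoning
  eq : ∀ x y → x - y ≡ 1ℤ * x + -1ℤ * y
  eq = solve-∀

infixl 6 _⊖_

_⊖_ : List ℤ → List ℤ → List ℤ
f       ⊖ []      = f
[]      ⊖ (y ∷ g) = - y ∷ ([] ⊖ g)
(x ∷ f) ⊖ (y ∷ g) = (x - y) ∷ (f ⊖ g)

act-⊖ : ∀ {n} f g (M : Matrix ℤ n n) u i → act (f ⊖ g) M u i ≡ act f M u i - act g M u i
act-⊖ []      []      M u i = refl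
act-⊖ (x ∷ f) []      M u i = sym (ℤ.+-identityʳ _)
act-⊖ []      (y ∷ g) M u i = begin
  - y * u i + (M *ᵛ act ([] ⊖ g) M u) i
    ≡⟨ cong (ℤ._+_ (- y * u i)) (*ᵛ-congʳ M (act-⊖ [] g M u) i) ⟩
  - y * u i + (M *ᵛ (λ k → 0ℤ - act g M u k)) i
    ≡⟨ cong (ℤ._+_ (- y * u i)) (*ᵛ-- M _ _ i) ⟩
  - y * u i + ((M *ᵛ (λ _ → 0ℤ)) i - (M *ᵛ act g M u) i)
    ≡⟨ cong (λ z → - y * u i + (z - (M *ᵛ act g M u) i)) (*ᵛ-zero M (λ _ → refl) i) ⟩
  - y * u i + (0ℤ - (M *ᵛ act g M u) i)
    ≡⟨ eq y (u i) ((M *ᵛ act g M u) i) ⟩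
  0ℤ - act (y ∷ g) M u i ∎
  where
  open ≡-Reasoning
  eq : ∀ y u w → - y * u + (0ℤ - w) ≡ 0ℤ - (y * u + w)
  eq = solve-∀
act-⊖ (x ∷ f) (y ∷ g) M u i = begin
  (x - y) * u i + (M *ᵛ act (f ⊖ g) M u) i
    ≡⟨ cong (ℤ._+_ ((x - y) * u i)) (*ᵛ-congʳ M (act-⊖ f g M u) i) ⟩
  (x - y) * u i + (M *ᵛ (λ k → act f M u k - act g M u k)) i
    ≡⟨ cong (ℤ._+_ ((x - y) * u i)) (*ᵛ-- M _ _ i) ⟩
  (x - y) * u i + ((M *ᵛ act f M u) i - (M *ᵛ act g M u) i)
    ≡⟨ eq x y (u i) ((M *ᵛ act f M u) i) ((M *ᵛ act g M u) i) ⟩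
  act (x ∷ f) M u i - act (y ∷ g) M u i ∎
  where
  open ≡-Reasoning
  eq : ∀ x y u v w → (x - y) * u + (v - w) ≡ (x * u + v) - (y * u + w)
  eq = solve-∀

-- The Cayley–Hamilton theorem over ℤ

row₀ : ∀ {n} → Matrix ℤ (suc n) (suc n) → Vector ℤ n
row₀ A j = A zero (suc j)

col₀ : ∀ {n} → Matrix ℤ (suc n) (suc n) → Vector ℤ n
col₀ A i = A (suc i) zero

minor : ∀ {n} → Matrix ℤ (suc n) (suc n) → Matrix ℤ n n
minor A i j = A (suc i) (suc j)

-- For A with corner a, first row r, first column s and minor M, this is the polynomial part of f(x)
-- (a + rs/x + rMs/x² + ...). The numbers a, rs, rMs, ... are, up to sign, the entries of the
-- Toeplitz matrix in the Samuelson-Berkowitz algorithm.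
border : ∀ {n} → Matrix ℤ (suc n) (suc n) → List ℤ → List ℤ
border A []      = []
border A (c ∷ f) = (A zero zero * c + dot (row₀ A) (act f (minor A) (col₀ A))) ∷ border A f

-- Samuelson's recursion: for A = [[a, r], [c, M]] the polynomial
-- x φ_M - border A φ_M annihilates the first basis vector as soon as φ_M(M) = 0.
charPoly : ∀ {n} → Matrix ℤ n n → List ℤ
charPoly {zero}  A = 1ℤ ∷ []
charPoly {suc n} A = (0ℤ ∷ charPoly (minor A)) ⊖ border A (charPoly (minor A))

extend : ∀ {n} → Vector ℤ n → Vector ℤ (suc n)
extend v zero    = 0ℤ
extend v (suc i) = v i

-- A maps (0, w) to (r w, M w), with r the first row and M the minor. So in each Horner step the
-- first coordinate is absorbed by a coefficient of `border`, and the rest evolves under M alone.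
act-border : ∀ {n} (A : Matrix ℤ (suc n) (suc n)) f i →
             act f A (λ k → A k zero) i ≡
             act (border A f) A (Id zero) i + extend (act f (minor A) (col₀ A)) i
act-border A []      zero    = refl
act-border A []      (suc i) = refl
act-border {n} A (c ∷ f) i = begin
  c * A i zero + (A *ᵛ act f A (λ k → A k zero)) i
    ≡⟨ cong (ℤ._+_ (c * A i zero)) (*ᵛ-congʳ A (act-border A f) i) ⟩
  c * A i zero + (A *ᵛ (λ k → act (border A f) A (Id zero) k + extend w k)) i
    ≡⟨ cong (ℤ._+_ (c * A i zero)) (*ᵛ-+ A (act (border A f) A (Id zero)) (extend w) i) ⟩
  c * A i zero + ((A *ᵛ act (border A f) A (Id zero)) i + (A *ᵛ extend w) i)
    ≡⟨ step i ⟩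
  act (border A (c ∷ f)) A (Id zero) i + extend (act (c ∷ f) (minor A) (col₀ A)) i ∎
  where
  open ≡-Reasoning
  w = act f (minor A) (col₀ A)
  eq₀ : ∀ c a x r → c * a + (x + (a * 0ℤ + r)) ≡ ((a * c + r) * 1ℤ + x) + 0ℤ
  eq₀ = solve-∀
  eq₁ : ∀ c s x y z → c * s + (x + (s * 0ℤ + y)) ≡ (z * 0ℤ + x) + (c * s + y)
  eq₁ = solve-∀
  step : ∀ i → c * A i zero + ((A *ᵛ act (border A f) A (Id zero)) i + (A *ᵛ extend w) i) ≡
               act (border A (c ∷ f)) A (Id zero) i + extend (act (c ∷ f) (minor A) (col₀ A)) i
  step zero    = eq₀ c (A zero zero) ((A *ᵛ act (border A f) A (Id zero)) zero) (dot (row₀ A) w)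
  step (suc i) = eq₁ c (A (suc i) zero) ((A *ᵛ act (border A f) A (Id zero)) (suc i)) ((minor A *ᵛ w) i)
                     (A zero zero * c + dot (row₀ A) w)

Annihilates : ∀ {n} → List ℤ → Matrix ℤ n n → Set
Annihilates f M = ∀ u i → act f M u i ≡ 0ℤ

charPoly-Id-zero : ∀ {n} (A : Matrix ℤ (suc n) (suc n)) → Annihilates (charPoly (minor A)) (minor A) →
                   ∀ i → act (charPoly A) A (Id zero) i ≡ 0ℤ
charPoly-Id-zero A ann i = begin
  act ((0ℤ ∷ c) ⊖ β) A (Id zero) i
    ≡⟨ act-⊖ (0ℤ ∷ c) β A (Id zero) i ⟩
  (0ℤ + (A *ᵛ act c A (Id zero)) i) - act β A (Id zero) i
    ≡⟨ cong (λ z → (0ℤ + z) - act β A (Id zero) i) shift ⟩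
  (0ℤ + (act β A (Id zero) i + 0ℤ)) - act β A (Id zero) i
    ≡⟨ eq (act β A (Id zero) i) ⟩
  0ℤ ∎
  where
  open ≡-Reasoning
  c = charPoly (minor A)
  β = border A c
  eq : ∀ x → (0ℤ + (x + 0ℤ)) - x ≡ 0ℤ
  eq = solve-∀
  vanish : ∀ i → extend (act c (minor A) (col₀ A)) i ≡ 0ℤ
  vanish zero    = refl
  vanish (suc i) = ann (col₀ A) i
  shift : (A *ᵛ act c A (Id zero)) i ≡ act β A (Id zero) i + 0ℤ
  shift = begin
    (A *ᵛ act c A (Id zero)) i  ≡⟨ act-comm c A (Id zero) i ⟩
    act c A (A *ᵛ Id zero) i    ≡⟨ act-congʳ c A (*ᵛ-Id A zero) i ⟩
    act c A (λ k → A k zero) i  ≡⟨ act-border A c i ⟩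
    act β A (Id zero) i + extend (act c (minor A) (col₀ A)) i
                                ≡⟨ cong (ℤ._+_ (act β A (Id zero) i)) (vanish i) ⟩
    act β A (Id zero) i + 0ℤ  ∎

module _ (m : ℕ) where
  private
    module Zm = CommutativeRing (ℤ/ m)
    module Lm = LinearAlgebra (ℤ/ m)
    _≈_ = _≡ₚ_ m

  ⊖-cong : ∀ {f f′ g g′} → Pointwise _≈_ f f′ → Pointwise _≈_ g g′ → Pointwise _≈_ (f ⊖ g) (f′ ⊖ g′)
  ⊖-cong f≈       []        = f≈
  ⊖-cong []       (y ∷ g≈)  = Zm.-‿cong y ∷ ⊖-cong [] g≈
  ⊖-cong (x ∷ f≈) (y ∷ g≈)  = Zm.+-cong x (Zm.-‿cong y) ∷ ⊖-cong f≈ g≈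

  border-cong : ∀ {n} {A B : Matrix ℤ (suc n) (suc n)} {f g} → (∀ i j → A i j ≈ B i j) →
                Pointwise _≈_ f g → Pointwise _≈_ (border A f) (border B g)
  border-cong A≈B []         = []
  border-cong {n} {A} {B} A≈B (c≈d ∷ f≈g) =
    Zm.+-cong (Zm.*-cong (A≈B zero zero) c≈d)
      (Lm.dot-cong {n} {row₀ A} {row₀ B} (λ j → A≈B zero (suc j))
        (Lm.act-cong f≈g (λ i j → A≈B (suc i) (suc j)) (λ i → A≈B (suc i) zero)))
    ∷ border-cong A≈B f≈g

  charPoly-cong : ∀ {n} {A B : Matrix ℤ n n} → (∀ i j → A i j ≈ B i j) →
                  Pointwise _≈_ (charPoly A) (charPoly B)
  charPoly-cong {zero}  A≈B = Zm.refl ∷ []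
  charPoly-cong {suc n} A≈B = ⊖-cong (Zm.refl ∷ c≈) (border-cong A≈B c≈)
    where c≈ = charPoly-cong (λ i j → A≈B (suc i) (suc j))

-- Each basis vector goes to the next one and the last to 0: the simplest matrix for which the first
-- basis vector is cyclic.
shift : ∀ {n} → Matrix ℤ (suc n) (suc n)
shift zero    j = 0ℤ
shift (suc i) j = Id (inject₁ i) j

shift-Id : ∀ {n} (k : Fin n) i → shift i (inject₁ k) ≡ Id (suc k) i
shift-Id k zero    = refl
shift-Id k (suc i) = go k i
  where
  go : ∀ {n} (k i : Fin n) → Id (inject₁ i) (inject₁ k) ≡ Id k i
  go zero    zero    = refl
  go zero    (suc i) = refl
  go (suc k) zero    = refl
  go (suc k) (suc i) = go k i

small-multiple : ∀ m z → ℤ.∣ z ∣ ℕ.< m → + m ∣ᶻ z → z ≡ 0ℤ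
small-multiple m z z<m m∣z = ℤ.∣i∣≡0⇒i≡0 (zero-if (ℤ.∣ z ∣) z<m (ℤ∣.∣⇒∣ᵤ m∣z))
  where
  zero-if : ∀ k → k ℕ.< m → m ℕ∣.∣ k → k ≡ 0
  zero-if zero    _   _   = refl
  zero-if (suc k) k<m m∣k with () ← ℕ.<⇒≱ k<m (ℕ∣.∣⇒≤ m∣k)

n<2+k^n : ∀ k n → n ℕ.< suc (suc k) ℕ.^ n
n<2+k^n k zero    = ℕ.≤-refl
n<2+k^n k (suc n) = begin-strict
  suc n                            <⟨ ℕ.s≤s (n<2+k^n k n) ⟩
  suc (b ℕ.^ n)                    ≤⟨ ℕ.+-monoˡ-≤ (b ℕ.^ n) (ℕ.m^n>0 b n) ⟩
  b ℕ.^ n ℕ.+ b ℕ.^ n              ≤⟨ ℕ.+-monoʳ-≤ (b ℕ.^ n) (ℕ.m≤m+n _ _) ⟩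
  b ℕ.* b ℕ.^ n                    ∎
  where
  open ℕ.≤-Reasoning
  b = suc (suc k)

module _ {n} (A : Matrix ℤ (suc n) (suc n)) (k : ℕ) where
  private
    N : ℕ
    N = suc (suc k)

    D : Matrix ℤ (suc n) (suc n)
    D i j = A i j - shift i j

  -- N = k + 2 is 1 modulo k + 1 and 0 modulo N, so this matrix is A modulo k + 1 and the shift
  -- modulo N.
  perturbed : Matrix ℤ (suc n) (suc n)
  perturbed i j = shift i j + + N * D i j

  perturbed-≡ : ∀ i j → _≡ₚ_ (suc k) (A i j) (perturbed i j)
  perturbed-≡ i j = congruent (divides (- D i j) (eq (A i j) (shift i j) (+ suc k)))
    where
    eq : ∀ a s m → a - (s + (1ℤ + m) * (a - s)) ≡ - (a - s) * m
    eq = solve-∀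

  private
    Id-suc : ∀ j i → Id (suc j) i ≡
             lincomb 1ℤ (perturbed *ᵛ Id (inject₁ j)) (- + N) (λ i → D i (inject₁ j)) i
    Id-suc j i = begin
      Id (suc j) i                        ≡⟨ shift-Id j i ⟨
      shift i (inject₁ j)                 ≡⟨ eq (shift i (inject₁ j)) (+ N) (D i (inject₁ j)) ⟩
      1ℤ * perturbed i (inject₁ j) + - + N * D i (inject₁ j)
        ≡⟨ cong (λ z → 1ℤ * z + - + N * D i (inject₁ j)) (*ᵛ-Id perturbed (inject₁ j) i) ⟨
      1ℤ * (perturbed *ᵛ Id (inject₁ j)) i + - + N * D i (inject₁ j) ∎
      where
      open ≡-Reasoning
      eq : ∀ s n d → s ≡ 1ℤ * (s + n * d) + - n * d
      eq = solve-∀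

  ∣-dot : ∀ {m d} (u v : Vector ℤ m) → (∀ i → d ∣ᶻ u i) → d ∣ᶻ dot u v
  ∣-dot {zero}  u v d∣u = divides 0ℤ refl
  ∣-dot {suc m} u v d∣u = ℤ∣.∣m∣n⇒∣m+n (ℤ∣.∣m⇒∣m*n (v zero) (d∣u zero))
                                     (∣-dot (λ i → u (suc i)) (λ i → v (suc i)) (λ i → d∣u (suc i)))

  -- Modulo N the perturbed matrix is the shift, so the first basis vector
  -- generates everything under it; divisibility by powers of N then bootstraps.
  perturbed-∣ : ∀ f → (∀ i → act f perturbed (Id zero) i ≡ 0ℤ) →
                ∀ K j i → + (N ℕ.^ K) ∣ᶻ act f perturbed (Id j) i
  perturbed-∣ f f₀ zero    j i = divides (act f perturbed (Id j) i) (sym (ℤ.*-identityʳ (act f perturbed (Id j) i)))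
  perturbed-∣ f f₀ (suc K) = <-weakInduction (λ j → ∀ i → + (N ℕ.^ suc K) ∣ᶻ act f perturbed (Id j) i)
    (λ i → subst (+ (N ℕ.^ suc K) ∣ᶻ_) (sym (f₀ i)) (divides 0ℤ refl)) step
    where
    step : ∀ j → (∀ i → + (N ℕ.^ suc K) ∣ᶻ act f perturbed (Id (inject₁ j)) i) →
           ∀ i → + (N ℕ.^ suc K) ∣ᶻ act f perturbed (Id (suc j)) i
    step j ih i = subst (+ (N ℕ.^ suc K) ∣ᶻ_) (sym eq)
      (ℤ∣.∣m∣n⇒∣m+n {+ (N ℕ.^ suc K)} {1ℤ * y} { - + N * act f perturbed x i}
        (ℤ∣.∣n⇒∣m*n {+ (N ℕ.^ suc K)} 1ℤ {y} first) second)
      where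
      x : Vector ℤ (suc n)
      x i = D i (inject₁ j)
      y : ℤ
      y = (perturbed *ᵛ act f perturbed (Id (inject₁ j))) i
      -- With P the perturbed matrix, e_{j+1} = P e_j - N x. In f(P) e_{j+1} the first term is
      -- divisible by induction on j; in the second, f(P) x has a factor N ^ K by induction on K,
      -- and N supplies one more.
      eq : act f perturbed (Id (suc j)) i ≡
           lincomb 1ℤ (perturbed *ᵛ act f perturbed (Id (inject₁ j))) (- + N) (act f perturbed x) i
      eq = trans (act-congʳ f perturbed (Id-suc j) i)
          (trans (act-linear f perturbed 1ℤ (perturbed *ᵛ Id (inject₁ j)) (- + N) x i)
                 (cong (λ z → 1ℤ * z + - + N * act f perturbed x i)
                       (sym (act-comm f perturbed (Id (inject₁ j)) i))))
      first : + (N ℕ.^ suc K) ∣ᶻ y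
      first = subst (+ (N ℕ.^ suc K) ∣ᶻ_) (dot-comm z (perturbed i))
              (∣-dot {d = + (N ℕ.^ suc K)} z (perturbed i) ih)
        where z = act f perturbed (Id (inject₁ j))
      N^K∣ : + (N ℕ.^ K) ∣ᶻ act f perturbed x i
      N^K∣ = subst (+ (N ℕ.^ K) ∣ᶻ_) (sym (act-matrix f perturbed x i))
                   (∣-dot {d = + (N ℕ.^ K)} (λ j → act f perturbed (Id j) i) x
                          (λ j → perturbed-∣ f f₀ K j i))
      second : + (N ℕ.^ suc K) ∣ᶻ - + N * act f perturbed x i
      second = subst (+ (N ℕ.^ suc K) ∣ᶻ_) (ℤ.neg-distribˡ-* (+ N) (act f perturbed x i))
        (ℤ∣.∣m⇒∣-m {+ (N ℕ.^ suc K)} {+ N * act f perturbed x i}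
          (subst (_∣ᶻ + N * act f perturbed x i) (sym (ℤ.pos-* N (N ℕ.^ K)))
            (ℤ∣.*-monoʳ-∣ (+ N) {+ (N ℕ.^ K)} {act f perturbed x i} N^K∣)))

  -- An integer z divisible by every power of N ≥ 2 is zero; the exponent |z| is already enough,
  -- since N to the |z| exceeds |z|.
  perturbed-annihilates : ∀ f → (∀ i → act f perturbed (Id zero) i ≡ 0ℤ) → Annihilates f perturbed
  perturbed-annihilates f f₀ u i = trans (act-matrix f perturbed u i) (dot-zeroˡ vanish u)
    where
    vanish : ∀ j → act f perturbed (Id j) i ≡ 0ℤ
    vanish j = small-multiple (N ℕ.^ ℤ.∣ z ∣) z (n<2+k^n k ℤ.∣ z ∣) (perturbed-∣ f f₀ ℤ.∣ z ∣ j i)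
      where z = act f perturbed (Id j) i

-- perturbed A k is congruent to A modulo k + 1, and k is arbitrary.
charPoly-annihilates : ∀ {n} (A : Matrix ℤ n n) → Annihilates (charPoly A) A
charPoly-annihilates {zero}  A u ()
charPoly-annihilates {suc n} A u i =
  small-multiple (suc k) z ℕ.≤-refl (subst (+ suc k ∣ᶻ_) (ℤ.+-identityʳ z) (_≡ₚ_.difference z≡0))
  where
  z = act (charPoly A) A u i
  -- Chosen so that the modulus k + 1 exceeds |z|, whence a zero residue means z = 0.
  k = ℤ.∣ z ∣
  module Lk = LinearAlgebra (ℤ/ (suc k))
  A≡P = perturbed-≡ A k
  z≡0 : _≡ₚ_ (suc k) z 0ℤ
  z≡0 = subst (_≡ₚ_ (suc k) z)
    (perturbed-annihilates A k (charPoly (perturbed A k))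
      (charPoly-Id-zero (perturbed A k) (charPoly-annihilates (minor (perturbed A k)))) u i)
    (Lk.act-cong {u = u} {v = u} (charPoly-cong (suc k) A≡P) A≡P (λ _ → CommutativeRing.refl (ℤ/ (suc k))) i)

-- Residue fields, and the characteristic polynomial of an alternating matrix modulo 2

module _ {p : ℕ} where
  ∣⇒≡0 : ∀ {x} → + p ∣ᶻ x → _≡ₚ_ p x 0ℤ
  ∣⇒≡0 {x} p∣x = congruent (subst (+ p ∣ᶻ_) (sym (ℤ.+-identityʳ x)) p∣x)

  ≡0⇒∣ : ∀ {x} → _≡ₚ_ p x 0ℤ → + p ∣ᶻ x
  ≡0⇒∣ {x} (congruent p∣x) = subst (+ p ∣ᶻ_) (ℤ.+-identityʳ x) p∣x

ℤ/-isIntegralDomain : ∀ {p} → Prime p → IsIntegralDomain (ℤ/ p)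
ℤ/-isIntegralDomain {p} p-prime = record
  { zero?            = λ x → map′ ∣⇒≡0 ≡0⇒∣ (+ p ℤ∣.∣? x)
  ; no-zero-divisors = λ x y xy≡0 → Sum.map (∣⇒≡0 ∘ ℤ∣.∣ᵤ⇒∣) (∣⇒≡0 ∘ ℤ∣.∣ᵤ⇒∣)
      (euclidsLemma ℤ.∣ x ∣ ℤ.∣ y ∣ p-prime (subst (p ℕ∣.∣_) (ℤ.abs-* x y) (ℤ∣.∣⇒∣ᵤ (≡0⇒∣ xy≡0))))
  ; 1≉0              = λ 1≡0 → ℕ.nonTrivial⇒≢1 {{prime⇒nonTrivial p-prime}} (ℕ∣.∣1⇒≡1 (ℤ∣.∣⇒∣ᵤ (≡0⇒∣ 1≡0)))
  }

ℤ/2-idempotent : ∀ x → _≡ₚ_ 2 (x * x) x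
ℤ/2-idempotent x = congruent (2∣x²-x x)
  where
  2∣n²+n : ∀ n → + 2 ∣ᶻ + n * + n + + n
  2∣n²+n zero    = divides 0ℤ refl
  2∣n²+n (suc n) with 2∣n²+n n
  ... | divides q eq = divides (q + (+ n + 1ℤ)) (trans (expand (+ n)) (trans (cong (_+ (+ n + 1ℤ) * + 2) eq) (factor q (+ n))))
    where
    expand : ∀ x → (1ℤ + x) * (1ℤ + x) + (1ℤ + x) ≡ (x * x + x) + (x + 1ℤ) * + 2
    expand = solve-∀
    factor : ∀ q x → q * + 2 + (x + 1ℤ) * + 2 ≡ (q + (x + 1ℤ)) * + 2
    factor = solve-∀
  2∣x²-x : ∀ x → + 2 ∣ᶻ x * x - x
  2∣x²-x (+ n) with 2∣n²+n n
  ... | divides q eq = divides (q - + n) (trans (shift-eq (+ n)) (trans (cong (_- + n * + 2) eq) (factor q (+ n))))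
    where
    shift-eq : ∀ x → x * x - x ≡ (x * x + x) - x * + 2
    shift-eq = solve-∀
    factor : ∀ q x → q * + 2 - x * + 2 ≡ (q - x) * + 2
    factor = solve-∀
  2∣x²-x ℤ.-[1+ n ] = subst (+ 2 ∣ᶻ_) (flip (+ suc n)) (2∣n²+n (suc n))
    where
    flip : ∀ x → x * x + x ≡ (- x) * (- x) - (- x)
    flip = solve-∀

length-border : ∀ {n} (A : Matrix ℤ (suc n) (suc n)) f → length (border A f) ≡ length f
length-border A []      = refl
length-border A (c ∷ f) = cong suc (length-border A f)

module _ (m : ℕ) where
  open Orbits (ℤ/ m)

  length-monic : ∀ {r f} → Monic r f → length f ≡ suc r
  length-monic (one _)      = refl
  length-monic (cons monic) = cong suc (length-monic monic)

  monic-⊖ : ∀ {r f} g → Monic r f → length g ℕ.≤ r → Monic r (f ⊖ g)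
  monic-⊖ []      monic        _             = monic
  monic-⊖ (y ∷ g) (cons monic) (ℕ.s≤s |g|≤r) = cons (monic-⊖ g monic |g|≤r)

  charPoly-monic : ∀ {n} (A : Matrix ℤ n n) → Monic n (charPoly A)
  charPoly-monic {zero}  A = one (CommutativeRing.refl (ℤ/ m))
  charPoly-monic {suc n} A = monic-⊖ (border A c) (cons monic)
    (ℕ.≤-reflexive (trans (length-border A c) (length-monic monic)))
    where
    c = charPoly (minor A)
    monic = charPoly-monic (minor A)

private
  module Z₂ = CommutativeRing (ℤ/ 2)
  module L₂ = LinearAlgebra (ℤ/ 2)
  open BooleanRing (ℤ/ 2) ℤ/2-idempotent

mutual
  ⊖-odd : ∀ {f g} → OddCoefficientsVanish f → OddCoefficientsVanish g → OddCoefficientsVanish (f ⊖ g)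
  ⊖-odd {f}     {[]}    fo go = fo
  ⊖-odd {[]}    {y ∷ g} fo go = ⊖-even {[]} {g} (lift _) go
  ⊖-odd {x ∷ f} {y ∷ g} fo go = ⊖-even {f} {g} fo go

  ⊖-even : ∀ {f g} → EvenCoefficientsVanish f → EvenCoefficientsVanish g → EvenCoefficientsVanish (f ⊖ g)
  ⊖-even {f}     {[]}    fe go = fe
  ⊖-even {[]}    {y ∷ g} fe (y≡0 , go) = Z₂.-‿cong y≡0 , ⊖-odd {[]} {g} (lift _) go
  ⊖-even {x ∷ f} {y ∷ g} (x≡0 , fo) (y≡0 , go) = Z₂.+-cong x≡0 (Z₂.-‿cong y≡0) , ⊖-odd {f} {g} fo go

module _ {n} {A : Matrix ℤ (suc n) (suc n)} (A≡Aᵀ : ∀ i j → _≡ₚ_ 2 (A i j) (A j i)) (Aᵢᵢ≡0 : ∀ i → _≡ₚ_ 2 (A i i) 0ℤ) where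
  mutual
    -- The corner is 0 and the first row is the transpose of the first column s, so the coefficients
    -- of `border` are sᵀg(M)s for the tails g of f. A tail with only odd powers contributes 0, as
    -- odd powers of the alternating minor M are alternating.
    border-even : ∀ f → OddCoefficientsVanish f → EvenCoefficientsVanish (border A f)
    border-even []      fo = lift _
    border-even (c ∷ f) fe =
      Z₂.+-cong {x = A zero zero * c} {y = 0ℤ}
        (Z₂.trans (Z₂.*-congʳ {c} (Aᵢᵢ≡0 zero)) (Z₂.zeroˡ c))
        (Z₂.trans (L₂.dot-cong {n} {u = row₀ A} {u′ = col₀ A} {v = act f (minor A) (col₀ A)} (λ j → A≡Aᵀ zero (suc j)) (λ _ → Z₂.refl))
                  (dot-act-zero (λ i j → A≡Aᵀ (suc i) (suc j)) (λ i → Aᵢᵢ≡0 (suc i)) f (col₀ A) fe))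
      , border-odd f fe

    border-odd : ∀ f → EvenCoefficientsVanish f → OddCoefficientsVanish (border A f)
    border-odd []      fe = lift _
    border-odd (c ∷ f) (_ , fo) = border-even f fo

ParityVanish : ℕ → List ℤ → Set
ParityVanish zero          f = OddCoefficientsVanish f
ParityVanish (suc zero)    f = EvenCoefficientsVanish f
ParityVanish (suc (suc n)) f = ParityVanish n f

-- The coefficient of degree n - i is up to sign the sum of the principal minors of order i, and
-- alternating matrices of odd order are singular. The recursion yields this without minors.
charPoly-parity : ∀ {n} (A : Matrix ℤ n n) → (∀ i j → _≡ₚ_ 2 (A i j) (A j i)) → (∀ i → _≡ₚ_ 2 (A i i) 0ℤ) →
                  ParityVanish n (charPoly A)
charPoly-parity {zero}  A A≡Aᵀ Aᵢᵢ≡0 = lift _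
charPoly-parity {suc n} A A≡Aᵀ Aᵢᵢ≡0 =
  step n (charPoly-parity (minor A) (λ i j → A≡Aᵀ (suc i) (suc j)) (λ i → Aᵢᵢ≡0 (suc i)))
  where
  c = charPoly (minor A)
  step : ∀ k → ParityVanish k c → ParityVanish (suc k) ((0ℤ ∷ c) ⊖ border A c)
  step zero          odd  = ⊖-even {0ℤ ∷ c} {border A c} (Z₂.refl , odd) (border-even A≡Aᵀ Aᵢᵢ≡0 c odd)
  step (suc zero)    even = ⊖-odd {0ℤ ∷ c} {border A c} even (border-odd A≡Aᵀ Aᵢᵢ≡0 c even)
  step (suc (suc k)) par  = step k par

module _ where
  open Orbits (ℤ/ 2) using (Monic; one; cons)

  evens-monic : ∀ k {f} → Monic (k ℕ.* 2) f → Monic k (evens f)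
  evens-monic zero    (one c≡1)            = one c≡1
  evens-monic (suc k) (cons (cons monic))  = cons (evens-monic k monic)

  private
    parity : ∀ n → Σ[ k ∈ ℕ ] (n ≡ k ℕ.* 2 ⊎ n ≡ suc (k ℕ.* 2))
    parity zero    = 0 , inj₁ refl
    parity (suc n) with parity n
    ... | k , inj₁ refl = k , inj₂ refl
    ... | k , inj₂ refl = suc k , inj₁ refl

    ⌊2k/2⌋ : ∀ k → ⌊ k ℕ.* 2 /2⌋ ≡ k
    ⌊2k/2⌋ zero    = refl
    ⌊2k/2⌋ (suc k) = cong suc (⌊2k/2⌋ k)

    ⌈2k/2⌉ : ∀ k → ⌈ k ℕ.* 2 /2⌉ ≡ k
    ⌈2k/2⌉ zero    = refl
    ⌈2k/2⌉ (suc k) = cong suc (⌈2k/2⌉ k)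

    odd-part : ∀ k {f} → ParityVanish (k ℕ.* 2) f → OddCoefficientsVanish f
    odd-part zero    vanish = vanish
    odd-part (suc k) vanish = odd-part k vanish

    even-part : ∀ k {f} → ParityVanish (suc (k ℕ.* 2)) f → EvenCoefficientsVanish f
    even-part zero    vanish = vanish
    even-part (suc k) vanish = even-part k vanish

  -- Modulo 2 the characteristic polynomial φ of an alternating matrix is a square
  -- or x times one, so that f² = φ or f² = x φ for a polynomial f.
  half-annihilator :
    ∀ {n} (A : Matrix ℤ n n) → (∀ i j → _≡ₚ_ 2 (A i j) (A j i)) → (∀ i → _≡ₚ_ 2 (A i i) 0ℤ) →
    ∃[ f ] (Monic ⌈ n /2⌉ f ×
      (∀ (M : Matrix ℤ n n) → (∀ i j → _≡ₚ_ 2 (M i j) (M j i)) → Annihilates (charPoly A) M →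
       ∀ i → _≡ₚ_ 2 (act f M ones i) 0ℤ))
  half-annihilator {n} A A≡Aᵀ Aᵢᵢ≡0 = go n refl (parity n)
    where
    φ = charPoly A
    monic = charPoly-monic 2 A
    vanish = charPoly-parity A A≡Aᵀ Aᵢᵢ≡0
    go : ∀ k → n ≡ k → Σ[ h ∈ ℕ ] (k ≡ h ℕ.* 2 ⊎ k ≡ suc (h ℕ.* 2)) →
      ∃[ f ] (Monic ⌈ n /2⌉ f ×
        (∀ (M : Matrix ℤ n n) → (∀ i j → _≡ₚ_ 2 (M i j) (M j i)) → Annihilates φ M →
         ∀ i → _≡ₚ_ 2 (act f M ones i) 0ℤ))
    go _ n≡k (k , inj₁ refl) =
      evens φ
      , subst (λ r → Monic r (evens φ)) (sym (trans (cong ⌈_/2⌉ n≡k) (⌈2k/2⌉ k)))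
          (evens-monic k (subst (λ r → Monic r φ) n≡k monic))
      , λ M M≡Mᵀ φM≡0 → evens-annihilates-ones φ M≡Mᵀ
          (odd-part k (subst (λ r → ParityVanish r φ) n≡k vanish)) (λ u i → Z₂.reflexive (φM≡0 u i))
    go _ n≡k (k , inj₂ refl) =
      -- Here n = 2k + 1, and x φ has degree 2(k + 1) and only even powers; k + 1 is ⌈n/2⌉.
      evens (0ℤ ∷ φ)
      , subst (λ r → Monic r (evens (0ℤ ∷ φ))) (sym (trans (cong ⌈_/2⌉ n≡k) (cong suc (⌊2k/2⌋ k))))
          (evens-monic (suc k) (cons (subst (λ r → Monic r φ) n≡k monic)))
      , λ M M≡Mᵀ φM≡0 → evens-annihilates-ones (0ℤ ∷ φ) M≡Mᵀ
          (even-part k (subst (λ r → ParityVanish r φ) n≡k vanish))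
          (λ u i → Z₂.reflexive (trans (ℤ.+-identityˡ _) (*ᵛ-zero M (φM≡0 u) i)))

-- Reduction modulo p of the integral identities

-- The walk vectors of B = QᵀAQ, which is kept as an integer matrix and not turned into a graph.
powers : ∀ {n} → Matrix ℤ n n → ℕ → Vector ℤ n
powers B zero    = ones
powers B (suc k) = B *ᵛ powers B k

module _ {m : ℕ} (G : Graph (suc m)) {B L : Matrix ℤ (suc m) (suc m)} {l : ℤ}
         (similarity : IsSimilarity (adjacency G) B L l)
         (Smith-form : Smith ℤ.+-*-commutativeRing (walkMatrix G)) where
  open IsSimilarity similarity
  private
    A = adjacency G
    W W′ : Matrix ℤ (suc m) (suc m)
    W = walkMatrix G
    W′ = krylovMatrix (powers B)

  module _ (L-start : ∀ i → (L *ᵛ ones) i ≡ l * 1ℤ) {p : ℕ} (p-prime : Prime p) where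
    private
      R = ℤ/ p
      module R = CommutativeRing R
      module S = Smith Smith-form
      isIntegralDomain = ℤ/-isIntegralDomain p-prime

      Smith-mod : Smith R W
      Smith-mod = record
        { U = S.U ; U⁻¹ = S.U⁻¹ ; V = S.V ; V⁻¹ = S.V⁻¹ ; D = S.D ; D* = S.D*
        ; UU⁻¹ = λ i j → R.reflexive (S.UU⁻¹ i j)
        ; U⁻¹U = λ i j → R.reflexive (S.U⁻¹U i j)
        ; VV⁻¹ = λ i j → R.reflexive (S.VV⁻¹ i j)
        ; UWV  = λ i j → R.reflexive (S.UWV i j)
        ; DD*  = λ k → R.reflexive (S.DD* k)
        }

      module Sₚ = Smith Smith-mod

    deficient⇒p∣d : ∀ {r} → HasRankMod p W r → r ℕ.< suc m → + p ∣ᶻ S.d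
    deficient⇒p∣d rank r≤m = ≡0⇒∣ (Sₚ.deficient⇒d≈0 isIntegralDomain rank r≤m)

    corank-1⇒p∣W′Y : HasRankMod p W m → ∀ x i → + p ∣ᶻ (W′ *ᵛ (S.Y *ᵛ x)) i
    corank-1⇒p∣W′Y rank x i = ≡0⇒∣ (Sₚ.corank-1⇒vanishes isIntegralDomain W′ {A} {B} rank
      (λ i j → R.reflexive (A-symmetric i j))
      (Orbits.orbit-krylov R {A = A} {a = walkVector G} (λ _ _ → R.refl))
      (Orbits.orbit-krylov R {A = B} {a = powers B} (λ _ _ → R.refl))
      (λ u v → R.reflexive (gram {walkVector G} {powers B} (λ _ _ → refl) (λ _ _ → refl) L-start u v))
      (Orbits.cokernel-invariant R {A = A} {a = walkVector G} (λ i j → R.reflexive (A-symmetric i j)) (λ _ _ → R.refl)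
        (charPoly-monic p A) (λ i → R.reflexive (charPoly-annihilates A ones i)))
      (λ x i → R.reflexive (scaled-intertwines {walkVector G} {powers B} (λ _ _ → refl) (λ _ _ → refl) L-start S.Y S.d S.WY x i))
      x i)

    half-rank⇒p∣W′Y : p ≡ 2 → HasRankMod p W ⌈ suc m /2⌉ → ⌈ suc m /2⌉ ℕ.< suc m →
                      ∀ x i → + p ∣ᶻ (W′ *ᵛ (S.Y *ᵛ x)) i
    half-rank⇒p∣W′Y refl rank r≤m x i = ≡0⇒∣ (Sₚ.transfer⇒vanishes isIntegralDomain W′ rank r≤m
      (Orbits.monic-kernel-transfer R isIntegralDomain {A = A} {B} {walkVector G} {powers B} (λ _ _ → R.refl) (λ _ _ → R.refl)
        (proj₁ (proj₂ half))
        (proj₂ (proj₂ half) A (λ i j → R.reflexive (A-symmetric i j)) (charPoly-annihilates A))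
        (proj₂ (proj₂ half) B (λ i j → R.reflexive (B-symmetric i j)) (annihilates-transfer (charPoly A) (charPoly-annihilates A)))
        rank) x i)
      where
      diagonal : ∀ i → A i i ≡ 0ℤ
      diagonal i rewrite Graph.irreflexive G i = refl
      half = half-annihilator A (λ i j → R.reflexive (A-symmetric i j)) (λ i → R.reflexive (diagonal i))

-- Clearing denominators

ι : ℤ → ℚ
ι z = z ℚ./ 1

private
  ιᵘ : ∀ z → ℚ.toℚᵘ (ι z) ℚᵘ.≃ ℚᵘ.mkℚᵘ z 0
  ιᵘ z = ℚ.toℚᵘ-fromℚᵘ (ℚᵘ.mkℚᵘ z 0)

ι-+ : ∀ x y → ι (x + y) ≡ ι x ℚ.+ ι y
ι-+ x y = ℚ.toℚᵘ-injective (begin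
  ℚ.toℚᵘ (ι (x + y))                  ≈⟨ ιᵘ (x + y) ⟩
  ℚᵘ.mkℚᵘ (x + y) 0                   ≈⟨ ℚᵘ.*≡* (eq x y) ⟩
  ℚᵘ.mkℚᵘ x 0 ℚᵘ.+ ℚᵘ.mkℚᵘ y 0        ≈⟨ ℚᵘ.+-cong (ιᵘ x) (ιᵘ y) ⟨
  ℚ.toℚᵘ (ι x) ℚᵘ.+ ℚ.toℚᵘ (ι y)      ≈⟨ ℚ.toℚᵘ-homo-+ (ι x) (ι y) ⟨
  ℚ.toℚᵘ (ι x ℚ.+ ι y)                ∎)
  where
  open import Relation.Binary.Reasoning.Setoid ℚᵘ.≃-setoid
  eq : ∀ x y → (x + y) * 1ℤ ≡ (x * 1ℤ + y * 1ℤ) * 1ℤ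
  eq = solve-∀

ι-* : ∀ x y → ι (x * y) ≡ ι x ℚ.* ι y
ι-* x y = ℚ.toℚᵘ-injective (begin
  ℚ.toℚᵘ (ι (x * y))                  ≈⟨ ιᵘ (x * y) ⟩
  ℚᵘ.mkℚᵘ x 0 ℚᵘ.* ℚᵘ.mkℚᵘ y 0        ≈⟨ ℚᵘ.*-cong (ιᵘ x) (ιᵘ y) ⟨
  ℚ.toℚᵘ (ι x) ℚᵘ.* ℚ.toℚᵘ (ι y)      ≈⟨ ℚ.toℚᵘ-homo-* (ι x) (ι y) ⟨
  ℚ.toℚᵘ (ι x ℚ.* ι y)                ∎)
  where open import Relation.Binary.Reasoning.Setoid ℚᵘ.≃-setoid

ι-injective : ∀ {x y} → ι x ≡ ι y → x ≡ y
ι-injective {x} {y} eq with ℚ.fromℚᵘ-injective {ℚᵘ.mkℚᵘ x 0} {ℚᵘ.mkℚᵘ y 0} eq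
... | ℚᵘ.*≡* x*1≡y*1 = trans (sym (ℤ.*-identityʳ x)) (trans x*1≡y*1 (ℤ.*-identityʳ y))

ι-dot : ∀ {n} (u v : Vector ℤ n) → ι (dot u v) ≡ Qᴸ.dot (ι ∘ u) (ι ∘ v)
ι-dot {zero}  u v = refl
ι-dot {suc n} u v = trans (ι-+ (u zero * v zero) (dot u⁺ v⁺)) (cong₂ ℚ._+_ (ι-* (u zero) (v zero)) (ι-dot u⁺ v⁺))
  where
  u⁺ v⁺ : Vector ℤ n
  u⁺ i = u (suc i)
  v⁺ i = v (suc i)

ι-Id : ∀ {n} (i j : Fin n) → ι (Id i j) ≡ ℚᴹ.Id i j
ι-Id i j with does (i ≟ j)
... | true  = refl
... | false = refl

ι-adjacency : ∀ {n} (G : Graph n) i j → ι (adjacency G i j) ≡ ℚᴹ.adjacency G i j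
ι-adjacency G i j with Graph.edge G i j
... | true  = refl
... | false = refl

zeroOne⇒integral : ∀ {m n} {X : Matrix ℚ m n} → IsZeroOne X → IsIntegral X
zeroOne⇒integral X-01 i j with X-01 i j
... | inj₁ X≡0 = 0ℤ , X≡0
... | inj₂ X≡1 = 1ℤ , X≡1

-- The integers k with kQ integral are closed under integer combinations, so a nonzero remainder of
-- k by l would contradict the minimality of l.
level-divides : ∀ {m n} {Q : Matrix ℚ m n} {l} → IsLevel Q l → ∀ k → IsIntegral (scale k Q) → l ∣ k
level-divides {Q = Q} {suc l-1} (_ , lQ-integral , minimal) k kQ-integral with k ℕ.% suc l-1 in eq
... | zero  = ℕ∣.m%n≡0⇒n∣m k (suc l-1) eq
... | suc s = contradiction (minimal (suc s) (ℕ.s≤s ℕ.z≤n) remainder-integral)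
                (ℕ.<⇒≱ (subst (ℕ._< suc l-1) eq (ℕ.m%n<n k (suc l-1))))
  where
  l = suc l-1
  t = k ℕ./ l
  k≡ : + suc s + + t * + l ≡ + k
  k≡ = trans (cong (_+_ (+ suc s)) (sym (ℤ.pos-* t l)))
             (sym (cong +_ (trans (ℕ.m≡m%n+[m/n]*n k l) (cong (ℕ._+ t ℕ.* l) eq))))
  remainder-integral : IsIntegral (scale (suc s) Q)
  remainder-integral i j = x - + t * y , (begin
    ι (+ suc s) ℚ.* q
      ≡⟨ cong (λ z → ι z ℚ.* q) (trans (cancel (+ suc s) (+ t) (+ l)) (cong (_+ - (+ t) * + l) k≡)) ⟩
    ι (+ k + - (+ t) * + l) ℚ.* q
      ≡⟨ cong (ℚ._* q) (trans (ι-+ (+ k) (- (+ t) * + l)) (cong (ι (+ k) ℚ.+_) (ι-* (- (+ t)) (+ l)))) ⟩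
    (ι (+ k) ℚ.+ ι (- (+ t)) ℚ.* ι (+ l)) ℚ.* q ≡⟨ ℚ.*-distribʳ-+ q (ι (+ k)) _ ⟩
    ι (+ k) ℚ.* q ℚ.+ ι (- (+ t)) ℚ.* ι (+ l) ℚ.* q ≡⟨ cong₂ ℚ._+_ (proj₂ (kQ-integral i j))
         (trans (ℚ.*-assoc (ι (- (+ t))) (ι (+ l)) q) (cong (ι (- (+ t)) ℚ.*_) (proj₂ (lQ-integral i j)))) ⟩
    ι x ℚ.+ ι (- (+ t)) ℚ.* ι y             ≡⟨ cong (ι x ℚ.+_) (ι-* (- (+ t)) y) ⟨
    ι x ℚ.+ ι (- (+ t) * y)                 ≡⟨ ι-+ x (- (+ t) * y) ⟨
    ι (x + - (+ t) * y)                     ≡⟨ cong (λ z → ι (x + z)) (ℤ.neg-distribˡ-* (+ t) y) ⟨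
    ι (x - + t * y)                         ∎)
    where
    open ≡-Reasoning
    q = Q i j
    x = proj₁ (kQ-integral i j)
    y = proj₁ (lQ-integral i j)
    cancel : ∀ s t l → s ≡ s + t * l + - t * l
    cancel = solve-∀

ℚ-cancelˡ : ∀ {r x y} → r ≢ ℚ.0ℚ → r ℚ.* x ≡ r ℚ.* y → x ≡ y
ℚ-cancelˡ {r} {x} {y} r≢0 rx≡ry = begin
  x                           ≡⟨ invert x ⟨
  (ℚ.1/ r) ℚ.* (r ℚ.* x)      ≡⟨ cong ((ℚ.1/ r) ℚ.*_) rx≡ry ⟩
  (ℚ.1/ r) ℚ.* (r ℚ.* y)      ≡⟨ invert y ⟩
  y                           ∎
  where
  open ≡-Reasoning
  instance r≠0 = ℚ.≢-nonZero r≢0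
  invert : ∀ z → (ℚ.1/ r) ℚ.* (r ℚ.* z) ≡ z
  invert z = trans (sym (ℚ.*-assoc (ℚ.1/ r) r z)) (trans (cong (ℚ._* z) (ℚ.*-inverseˡ r)) (ℚ.*-identityˡ z))

adjacency-symmetric : ∀ {n} (G : Graph n) i j → adjacency G i j ≡ adjacency G j i
adjacency-symmetric G i j rewrite Graph.symmetric G i j = refl

module Scaling {n} (G : Graph n) {Q : Matrix ℚ n n} (Q∈𝒬 : Q ∈𝒬 G) {l : ℕ} (0<l : 0 ℕ.< l)
               (lQ-integral : IsIntegral (scale l Q)) where
  private
    λᵣ : ℚ
    λᵣ = ι (+ l)
    A  = adjacency G
    Aℚ = ℚᴹ.adjacency G
    Bℚ = ((Q ᵀ) ℚᴹ.*ᴹ Aℚ) ℚᴹ.*ᴹ Q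
    B-integral = zeroOne⇒integral (proj₂ Q∈𝒬)
    QQᵀ = proj₁ (proj₁ (proj₁ Q∈𝒬))
    QᵀQ = proj₂ (proj₁ (proj₁ Q∈𝒬))

  L B : Matrix ℤ n n
  L i j = proj₁ (lQ-integral i j)
  B i j = proj₁ (B-integral i j)

  ιL : ∀ i j → ι (L i j) ≡ λᵣ ℚ.* Q i j
  ιL i j = sym (proj₂ (lQ-integral i j))

  λᵣ≢0 : λᵣ ≢ ℚ.0ℚ
  λᵣ≢0 λᵣ≡0 = ℕ.<⇒≢ 0<l (sym (ℤ.+-injective (ι-injective λᵣ≡0)))

  private
    open ≡-Reasoning

    ι-dot-L : ∀ i (u : Vector ℤ n) → ι (dot (L i) u) ≡ λᵣ ℚ.* Qᴸ.dot (Q i) (ι ∘ u)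
    ι-dot-L i u = begin
      ι (dot (L i) u)                             ≡⟨ ι-dot (L i) u ⟩
      Qᴸ.dot (ι ∘ L i) (ι ∘ u)                    ≡⟨ Qᴸ.dot-cong {v = ι ∘ u} (ιL i) (λ _ → refl) ⟩
      Qᴸ.dot (λ k → λᵣ ℚ.* Q i k) (ι ∘ u)         ≡⟨ Qᴸ.dot-comm _ (ι ∘ u) ⟩
      Qᴸ.dot (ι ∘ u) (λ k → λᵣ ℚ.* Q i k)         ≡⟨ Qᴸ.dot-scale (ι ∘ u) λᵣ (Q i) ⟩
      λᵣ ℚ.* Qᴸ.dot (ι ∘ u) (Q i)                 ≡⟨ cong (λᵣ ℚ.*_) (Qᴸ.dot-comm (ι ∘ u) (Q i)) ⟩
      λᵣ ℚ.* Qᴸ.dot (Q i) (ι ∘ u)                 ∎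

    ι-dot-Lᵀ : ∀ j (u : Vector ℤ n) → ι (dot u ((L ᵀ) j)) ≡ λᵣ ℚ.* Qᴸ.dot (ι ∘ u) ((Q ᵀ) j)
    ι-dot-Lᵀ j u = begin
      ι (dot u ((L ᵀ) j))                         ≡⟨ ι-dot u ((L ᵀ) j) ⟩
      Qᴸ.dot (ι ∘ u) (ι ∘ (L ᵀ) j)
        ≡⟨ Qᴸ.dot-cong {u = ι ∘ u} (λ _ → refl) (λ k → ιL k j) ⟩
      Qᴸ.dot (ι ∘ u) (λ k → λᵣ ℚ.* Q k j)         ≡⟨ Qᴸ.dot-scale (ι ∘ u) λᵣ ((Q ᵀ) j) ⟩
      λᵣ ℚ.* Qᴸ.dot (ι ∘ u) ((Q ᵀ) j)             ∎

    LB≡AL : ∀ i j → (L *ᴹ B) i j ≡ (A *ᴹ L) i j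
    LB≡AL i j = ι-injective (begin
      ι (dot (L i) (λ k → B k j))                  ≡⟨ ι-dot-L i (λ k → B k j) ⟩
      λᵣ ℚ.* Qᴸ.dot (Q i) (λ k → ι (B k j))        ≡⟨ cong (λᵣ ℚ.*_) (Qᴸ.dot-cong {u = Q i} (λ _ → refl)
                                                        (λ k → trans (sym (proj₂ (B-integral k j))) (Qᴸ.*ᴹ-*ᵛ (Q ᵀ) Aℚ ((Q ᵀ) j) k))) ⟩
      λᵣ ℚ.* (Q ℚᴹ.*ᵛ ((Q ᵀ) ℚᴹ.*ᵛ (Aℚ ℚᴹ.*ᵛ (Q ᵀ) j))) i
                                                   ≡⟨ cong (λᵣ ℚ.*_) (Qᴸ.inverse-*ᵛ {X = Q} {Q ᵀ} QQᵀ (Aℚ ℚᴹ.*ᵛ (Q ᵀ) j) i) ⟩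
      λᵣ ℚ.* Qᴸ.dot (Aℚ i) ((Q ᵀ) j)
        ≡⟨ cong (λᵣ ℚ.*_) (Qᴸ.dot-cong {v = (Q ᵀ) j} (ι-adjacency G i) (λ _ → refl)) ⟨
      λᵣ ℚ.* Qᴸ.dot (ι ∘ A i) ((Q ᵀ) j)            ≡⟨ ι-dot-Lᵀ j (A i) ⟨
      ι ((A *ᴹ L) i j)                             ∎)

    LᵀL : ∀ i j → ((L ᵀ) *ᴹ L) i j ≡ + l * (+ l * Id i j)
    LᵀL i j = ι-injective (begin
      ι (dot ((L ᵀ) i) ((L ᵀ) j))                  ≡⟨ ι-dot-Lᵀ j ((L ᵀ) i) ⟩
      λᵣ ℚ.* Qᴸ.dot (ι ∘ (L ᵀ) i) ((Q ᵀ) j)        ≡⟨ cong (λᵣ ℚ.*_) (trans (Qᴸ.dot-cong {v = (Q ᵀ) j} (λ k → ιL k i) (λ _ → refl))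
                                                        (Qᴸ.dot-comm (λ k → λᵣ ℚ.* Q k i) ((Q ᵀ) j))) ⟩
      λᵣ ℚ.* Qᴸ.dot ((Q ᵀ) j) (λ k → λᵣ ℚ.* Q k i)
        ≡⟨ cong (λᵣ ℚ.*_) (Qᴸ.dot-scale ((Q ᵀ) j) λᵣ ((Q ᵀ) i)) ⟩
      λᵣ ℚ.* (λᵣ ℚ.* Qᴸ.dot ((Q ᵀ) j) ((Q ᵀ) i))
        ≡⟨ cong (λ z → λᵣ ℚ.* (λᵣ ℚ.* z)) (trans (QᵀQ j i) (Qᴸ.Id-sym j i)) ⟩
      λᵣ ℚ.* (λᵣ ℚ.* ℚᴹ.Id i j)                    ≡⟨ cong (λ z → λᵣ ℚ.* (λᵣ ℚ.* z)) (ι-Id i j) ⟨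
      λᵣ ℚ.* (λᵣ ℚ.* ι (Id i j))                   ≡⟨ cong (λᵣ ℚ.*_) (ι-* (+ l) (Id i j)) ⟨
      λᵣ ℚ.* ι (+ l * Id i j)                      ≡⟨ ι-* (+ l) (+ l * Id i j) ⟨
      ι (+ l * (+ l * Id i j))                     ∎)

  L-start : ∀ i → (L *ᵛ ones) i ≡ + l * 1ℤ
  L-start i = ι-injective (begin
    ι (dot (L i) ones)                  ≡⟨ ι-dot-L i ones ⟩
    λᵣ ℚ.* Qᴸ.dot (Q i) (λ _ → ℚ.1ℚ)    ≡⟨ cong (λᵣ ℚ.*_) (proj₂ (proj₁ Q∈𝒬) i) ⟩
    λᵣ ℚ.* ℚ.1ℚ                         ≡⟨ ι-* (+ l) 1ℤ ⟨
    ι (+ l * 1ℤ)                        ∎)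

  similarity : IsSimilarity A B L (+ l)
  similarity = record
    { A-symmetric = adjacency-symmetric G
    ; intertwines = λ v i → begin
        (L *ᵛ (B *ᵛ v)) i     ≡⟨ *ᴹ-*ᵛ L B v i ⟨
        ((L *ᴹ B) *ᵛ v) i     ≡⟨ *ᵛ-cong {u = v} LB≡AL (λ _ → refl) i ⟩
        ((A *ᴹ L) *ᵛ v) i     ≡⟨ *ᴹ-*ᵛ A L v i ⟩
        (A *ᵛ (L *ᵛ v)) i     ∎
    ; isometry    = λ v i → begin
        ((L ᵀ) *ᵛ (L *ᵛ v)) i                ≡⟨ *ᴹ-*ᵛ (L ᵀ) L v i ⟨
        dot (((L ᵀ) *ᴹ L) i) v               ≡⟨ dot-comm (((L ᵀ) *ᴹ L) i) v ⟩
        dot v (((L ᵀ) *ᴹ L) i)               ≡⟨ dot-cong {u = v} (λ _ → refl) (LᵀL i) ⟩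
        dot v (λ j → + l * (+ l * Id i j))   ≡⟨ dot-scale v (+ l) (λ j → + l * Id i j) ⟩
        + l * dot v (λ j → + l * Id i j)     ≡⟨ cong (+ l *_) (dot-scale v (+ l) (Id i)) ⟩
        + l * (+ l * dot v (Id i))
          ≡⟨ cong (λ z → + l * (+ l * z)) (trans (dot-comm v (Id i)) (Id-*ᵛ v i)) ⟩
        + l * (+ l * v i)                    ∎
    ; l-cancel    = λ x y → ℤ.*-cancelˡ-≡ (+ l) x y {{ℕ.>-nonZero 0<l}}
    }

-- Invariant factors and the conclusion

-- The divisibility chain provides the cofactors D* over ℤ. They are carried along as data because D
-- k * D* k = d no longer determines them once D k vanishes modulo p.
invariantFactors⇒Smith : ∀ {m} {W : Matrix ℤ (suc m) (suc m)} {d} → IsInvariantFactors W d → Smith ℤ.+-*-commutativeRing W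
invariantFactors⇒Smith {m} {d = d} (d-chain , U , V , (U⁻¹ , UU⁻¹ , U⁻¹U) , (V⁻¹ , VV⁻¹ , _) , UWV) = record
  { U = U ; U⁻¹ = U⁻¹ ; V = V ; V⁻¹ = V⁻¹
  ; D = λ k → + d k ; D* = λ k → + quotient (d∣dₙ k)
  ; UU⁻¹ = UU⁻¹ ; U⁻¹U = U⁻¹U ; VV⁻¹ = VV⁻¹ ; UWV = UWV
  ; DD* = λ k → trans (sym (ℤ.pos-* (d k) (quotient (d∣dₙ k))))
      (cong +_ (trans (ℕ.*-comm (d k) (quotient (d∣dₙ k))) (sym (_∣_.equality (d∣dₙ k)))))
  }
  where
  d∣dₙ : ∀ k → d k ∣ d (fromℕ m)
  d∣dₙ k = d-chain k (fromℕ m) (≤fromℕ k)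

theorem2p8 : (m : ℕ) → let n = suc m in
    (G : Graph n) → let W = ℤᴹ.walkMatrix G in
    ℤᴹ.det W ≢ 0ℤ →
    (d : Vector ℕ n) → IsInvariantFactors W d → let dₙ = d (fromℕ m) in
    (Q : Matrix ℚ n n) → Q ∈𝒬 G →
    (l : ℕ) → IsLevel Q l →
    ((p : ℕ) → Prime p → ¬ (2 ∣ p) → HasRankMod p W (n ∸ 1) → DividesQuotient l dₙ p)
    × (2 ≤ n → HasRankMod 2 W ⌈ n /2⌉ → DividesQuotient l dₙ 2)
theorem2p8 m G _ d invariantFactors Q Q∈𝒬 l level@(0<l , lQ-integral , _) =
  (λ p p-prime _ rank → conclude p p-prime (deficient⇒p∣d G similarity form L-start p-prime rank (ℕ.n<1+n m))
    (corank-1⇒p∣W′Y G similarity form L-start p-prime rank)) ,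
  (λ 2≤n rank → conclude 2 prime[2] (deficient⇒p∣d G similarity form L-start prime[2] rank (⌈n/2⌉<n 2≤n))
    (half-rank⇒p∣W′Y G similarity form L-start prime[2] refl rank (⌈n/2⌉<n 2≤n)))
  where
  open Scaling G Q∈𝒬 0<l lQ-integral
  form = invariantFactors⇒Smith invariantFactors
  Y = Smith.Y form
  W′ : Matrix ℤ (suc m) (suc m)
  W′ = krylovMatrix (powers B)
  dₙ = d (fromℕ m)

  -- For n = 1 the ceiling is n itself: then W = [1] and d = 1, which 2 does not divide. From n = 2
  -- on the rank is deficient and 2 ∣ d follows.
  ⌈n/2⌉<n : 2 ≤ suc m → ⌈ suc m /2⌉ ℕ.< suc m
  ⌈n/2⌉<n (ℕ.s≤s (ℕ.s≤s {n = k} _)) = ℕ.⌈n/2⌉<n k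

  conclude : ∀ p → Prime p → + p ∣ᶻ + dₙ → (∀ x i → + p ∣ᶻ (W′ *ᵛ (Y *ᵛ x)) i) → DividesQuotient l dₙ p
  conclude p p-prime +p∣+d p∣W′Y = p∣d , level-divides level q qQ-integral
    where
    open ≡-Reasoning
    p∣d : p ∣ dₙ
    p∣d = ℤ∣.∣⇒∣ᵤ +p∣+d
    q = quotient p∣d
    qQ-integral : IsIntegral (scale q Q)
    qQ-integral i j = z , ℚ-cancelˡ λᵣ≢0 (begin
      ι (+ l) ℚ.* (ι (+ q) ℚ.* Q i j)    ≡⟨ ℚ.*-assoc (ι (+ l)) (ι (+ q)) (Q i j) ⟨
      (ι (+ l) ℚ.* ι (+ q)) ℚ.* Q i j    ≡⟨ cong (ℚ._* Q i j) (ℚ.*-comm (ι (+ l)) (ι (+ q))) ⟩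
      (ι (+ q) ℚ.* ι (+ l)) ℚ.* Q i j    ≡⟨ ℚ.*-assoc (ι (+ q)) (ι (+ l)) (Q i j) ⟩
      ι (+ q) ℚ.* (ι (+ l) ℚ.* Q i j)    ≡⟨ cong (ι (+ q) ℚ.*_) (ιL i j) ⟨
      ι (+ q) ℚ.* ι (L i j)              ≡⟨ ι-* (+ q) (L i j) ⟨
      ι (+ q * L i j)                    ≡⟨ cong ι qL≡lz ⟩
      ι (+ l * z)                        ≡⟨ ι-* (+ l) z ⟩
      ι (+ l) ℚ.* ι z                    ∎)
      where
      -- Entry (j, i) of W′Y = d Qᵀ is d times Q i j, so the quotient z by p is the required integer
      -- (d / p) Q i j.
      divisible = p∣W′Y (Id i) j
      z : ℤ
      z = ℤ∣._∣_.quotient divisible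
      r : ℤ
      r = (W′ *ᵛ (Y *ᵛ Id i)) j
      qL≡lz : + q * L i j ≡ + l * z
      qL≡lz = ℤ.*-cancelʳ-≡ (+ q * L i j) (+ l * z) (+ p) {{prime⇒nonZero p-prime}} (begin
        + q * L i j * + p       ≡⟨ swap (+ q) (L i j) (+ p) ⟩
        + q * + p * L i j
          ≡⟨ cong (_* L i j) (trans (sym (ℤ.pos-* q p)) (cong +_ (sym (_∣_.equality p∣d)))) ⟩
        + dₙ * L i j            ≡⟨ cong (+ dₙ *_) (*ᵛ-Id (L ᵀ) i j) ⟨
        + dₙ * ((L ᵀ) *ᵛ Id i) j
          ≡⟨ IsSimilarity.scaled-transpose similarity {walkVector G} {powers B} (λ _ _ → refl) (λ _ _ → refl) L-start Y (+ dₙ) (Smith.WY form) (Id i) j ⟨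
        + l * r                 ≡⟨ cong (+ l *_) (ℤ∣._∣_.equality divisible) ⟩
        + l * (z * + p)         ≡⟨ ℤ.*-assoc (+ l) z (+ p) ⟨
        + l * z * + p           ∎)
        where
        swap : ∀ x y z → x * y * z ≡ x * z * y
        swap = solve-∀
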